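{- Let $X$ be a standard Borel space and let $E$ be an aperiodic hyperfinite equivalence relation on $X$. Let $n,k\geq 1$ be integers. Then for any Borel almost transitive $E$-coloring $c:[X]^n_E\to\{1,\dots,k\}$, there is a Borel monochromatic reduction $S:X\to X^{\mathbb{N}}$ to $E_1$ for $c$.
   Context: An equivalence relation $E$ on a standard Borel space $X$ is a Borel equivalence relation if $E$ is a Borel subset of $X^2$; it is countable if every $E$-class is countable, finite if every $E$-class is finite, and aperiodic if every $E$-class is infinite. $E$ is hyperfinite if there is an increasing sequence $\{F_i\}_{i\in\mathbb{N}}$ of finite Borel equivalence relations on $X$ with $E=\bigcup_i F_i$. $[x]_E$ denotes the $E$-class of $x$, and $[A]_E$ the $E$-saturation of $A\subseteq X$. For an integer $n>0$, $[X]^n$ is the set of $n$-element subsets of $X$, and $[X]^n_E=\{A\in[X]^n: \exists x\in X\ (A\subseteq [x]_E)\}$. Fixing a Borel linear ordering $<$ of $X$ and listing the elements of each $A\in[X]^n$ in $<$-increasing order identifies $[X]^n_E$ with a Borel subset of $X^n$, so it is a standard Borel space. An $E$-coloring (of dimension $n$ by $k$ many colors) is a function $c:[X]^n_E\to\{1,\dots,k\}$; it is a Borel $E$-coloring if it is Borel. An $E$-coloring $c:[X]^n_E\to\{1,\dots,k\}$ is almost transitive if for any integer $m\geq n$, any $A\in[X]^m_E$ and any $B_1,B_2\in[A]^{n-1}$ (the $(n-1)$-element subsets of $A$), we have $c(\{z\}\cup B_1)=c(\{z\}\cup B_2)$ for all but finitely many $z\in[A]_E\setminus(B_1\cup B_2)$.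 $E_1$ denotes the equivalence relation of eventual equality on $X^{\mathbb{N}}$: $u\,E_1\,v\iff \exists i\ \forall j\geq i\ u(j)=v(j)$. Given an $E$-coloring $c:[X]^n_E\to\{1,\dots,k\}$, a function $S:X\to X^{\mathbb{N}}$ is a monochromatic reduction to $E_1$ for $c$ if: (1) for any $x\in X$ and distinct $i,j\in\mathbb{N}$, $S(x)(i)\neq S(x)(j)$; (2) for any $x\in X$, the set $\{S(x)(i): i\in\mathbb{N}\}$ is a monochromatic subset of $[x]_E$, i.e. it is contained in $[x]_E$ and $c$ is constant on its $n$-element subsets; (3) for any $x,y\in X$, $xEy$ iff $S(x)\,E_1\,S(y)$. -}

module Defs where

open import Data.Bool.Base using (Bool; if_then_else_)
open import Data.Fin.Base using (Fin)
open import Data.List.Base using (List)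
import Data.List.Membership.Propositional as List
open import Data.Maybe.Base using (Maybe; just)
open import Data.Nat.Base using (ℕ; suc; pred; NonZero; _≤_)
open import Data.Product.Base using (Σ-syntax; ∃; ∃-syntax; _×_; _,_; proj₁; proj₂; uncurry)
open import Data.Rational.Base as ℚ using (ℚ; 0ℚ)
open import Data.Sum.Base using (inj₁; inj₂)
open import Data.Unit.Base using () renaming (⊤ to Unit)
open import Data.Unit.Polymorphic.Base using (⊤)
open import Data.Vec.Base using (Vec; _∷_; lookup)
open import Data.Vec.Membership.Propositional using () renaming (_∈_ to _∈ᵛ_)
open import Data.Vec.Membership.Propositional.Properties using (∈-lookup)
open import Data.Vec.Relation.Unary.All as All using (All)
open import Data.Vec.Relation.Unary.All.Properties using (lookup⁻)
open import Data.Vec.Relation.Unary.AllPairs as AllPairs using (AllPairs; _∷_)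
open import Data.Vec.Relation.Unary.Any using (here; there)
open import Data.Vec.Relation.Unary.Unique.Propositional using (Unique)
open import Function.Base using (_∘_; id)
open import Function.Bundles using (_⇔_)
open import Level as Level using (Level; _⊔_; 0ℓ)
open import Relation.Binary.Core using (Rel; _⇒_)
open import Relation.Binary.Structures using (IsEquivalence; IsStrictTotalOrder)
open import Relation.Binary.PropositionalEquality
  using (_≡_; _≢_; refl; sym)
open import Relation.Nullary.Negation.Core using (¬_)
open import Relation.Unary using (Pred; _∈_; _∉_; _⊆_; _≐_; _⊢_; ∁; ⋃; _∪_; ｛_｝; U)

-- Subsets of X are predicates, compared by mutual inclusion _≐_; every notion
-- below that takes a subset is invariant under _≐_.

Finite : {X : Set} → Pred X 0ℓ → Set
Finite {X} A = Σ[ xs ∈ List X ] (A ⊆ (List._∈ xs))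

-- "A has exactly n elements": A is listed without repetition by a vector of
-- length n.
HasSize : {X : Set} → ℕ → Pred X 0ℓ → Set
HasSize {X} n A = Σ[ v ∈ Vec X n ] (Unique v × A ≐ (_∈ᵛ v))

record σ-Algebra (X : Set) : Set₂ where
  field
    Measurable : Pred X 0ℓ → Set₁
    resp-≐     : ∀ {A B} → A ≐ B → Measurable A → Measurable B
    whole      : Measurable U
    complement : ∀ {A} → Measurable A → Measurable (∁ A)
    union      : ∀ {A : ℕ → Pred X 0ℓ} → (∀ i → Measurable (A i)) → Measurable (⋃ ℕ A)

open σ-Algebra public using (Measurable)

data Generated {g : Level} {X : Set} (G : Pred X 0ℓ → Set g) : Pred X 0ℓ → Set (Level.suc 0ℓ ⊔ g) where
  basic      : ∀ {A} → G A → Generated G A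
  resp-≐     : ∀ {A B} → A ≐ B → Generated G A → Generated G B
  whole      : Generated G U
  complement : ∀ {A} → Generated G A → Generated G (∁ A)
  union      : ∀ {A : ℕ → Pred X 0ℓ} → (∀ i → Generated G (A i)) → Generated G (⋃ ℕ A)

-- The least σ-algebra on Z making every f i measurable.
initial : {I Z X : Set} → σ-Algebra X → (I → Z → X) → σ-Algebra Z
initial {I} {Z} {X} 𝓑 f = record
  { Measurable = Generated λ A →
      Σ[ i ∈ I ] Σ[ B ∈ Pred X 0ℓ ] (Measurable 𝓑 B × A ≐ (f i ⊢ B))
  ; resp-≐     = resp-≐
  ; whole      = whole
  ; complement = complement
  ; union      = union
  }

square : {X : Set} → σ-Algebra X → σ-Algebra (X × X)
square 𝓑 = initial 𝓑 (λ (b : Bool) → if b then proj₁ else proj₂)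

power : {X : Set} → σ-Algebra X → (n : ℕ) → σ-Algebra (Vec X n)
power 𝓑 n = initial 𝓑 (λ (i : Fin n) v → lookup v i)

sequences : {X : Set} → σ-Algebra X → σ-Algebra (ℕ → X)
sequences 𝓑 = initial 𝓑 (λ (i : ℕ) u → u i)

subspace : {X : Set} → σ-Algebra X → (D : Pred X 0ℓ) → σ-Algebra (∃ D)
subspace 𝓑 D = initial 𝓑 (λ (_ : Unit) → proj₁)

discrete : (X : Set) → σ-Algebra X
discrete X = record
  { Measurable = λ _ → ⊤
  ; resp-≐     = λ _ _ → _
  ; whole      = _
  ; complement = λ _ → _
  ; union      = λ _ → _
  }

IsMeasurableMap : {X Y : Set} → σ-Algebra X → σ-Algebra Y → (X → Y) → Set₁
IsMeasurableMap {Y = Y} 𝓐 𝓑 f =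
  (B : Pred Y 0ℓ) → Measurable 𝓑 B → Measurable 𝓐 (f ⊢ B)

-- A complete separable metric.  The real-valued distance d is given by the
-- Dedekind cuts of its values: d< x y q stands for "d(x,y) < q".
record PolishMetric (X : Set) : Set₁ where
  field
    d<         : X → X → ℚ → Set
    -- For all x y, the set of q with d(x,y) < q is the upper cut of a real ≥ 0.
    nonneg     : ∀ {x y q} → d< x y q → 0ℚ ℚ.< q
    finite     : ∀ x y → ∃[ q ] d< x y q
    upward     : ∀ {x y p q} → p ℚ.< q → d< x y p → d< x y q
    rounded    : ∀ {x y q} → d< x y q → ∃[ p ] (p ℚ.< q × d< x y p)
    d-refl     : ∀ {x q} → 0ℚ ℚ.< q → d< x x q
    separated  : ∀ {x y} → (∀ {q} → 0ℚ ℚ.< q → d< x y q) → x ≡ y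
    d-sym      : ∀ {x y q} → d< x y q → d< y x q
    triangle   : ∀ {x y z p q} → d< x y p → d< y z q → d< x z (p ℚ.+ q)

  Cauchy : (ℕ → X) → Set
  Cauchy s = ∀ {ε} → 0ℚ ℚ.< ε →
    ∃[ N ] (∀ {i j} → N ≤ i → N ≤ j → d< (s i) (s j) ε)

  _⟶_ : (ℕ → X) → X → Set
  s ⟶ x = ∀ {ε} → 0ℚ ℚ.< ε → ∃[ N ] (∀ {i} → N ≤ i → d< (s i) x ε)

  field
    complete   : ∀ s → Cauchy s → ∃[ x ] (s ⟶ x)
    -- Maybe allows the empty space.
    denseSeq   : ℕ → Maybe X
    dense      : ∀ x {ε} → 0ℚ ℚ.< ε →
                 ∃[ i ] Σ[ y ∈ X ] (denseSeq i ≡ just y × d< x y ε)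

  Open : Pred X 0ℓ → Set
  Open A = ∀ {x} → x ∈ A → ∃[ ε ] (0ℚ ℚ.< ε × (λ y → d< x y ε) ⊆ A)

record StandardBorelSpace : Set₂ where
  field
    Carrier   : Set
    borel     : σ-Algebra Carrier
    metric    : PolishMetric Carrier
    generates : ∀ A → Measurable borel A ⇔ Generated (PolishMetric.Open metric) A

open StandardBorelSpace public using (Carrier; borel)

BorelRel : (X : StandardBorelSpace) → Rel (Carrier X) 0ℓ → Set₁
BorelRel X R = Measurable (square (borel X)) (uncurry R)

record IsBorelLinearOrder (X : StandardBorelSpace) (_<_ : Rel (Carrier X) 0ℓ) : Set₁ where
  field
    isStrictTotalOrder : IsStrictTotalOrder _≡_ _<_
    isBorel            : BorelRel X _<_

-- The class [x]_E is the predicate E x.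

Aperiodic : {X : Set} → Rel X 0ℓ → Set
Aperiodic E = ∀ x → ¬ Finite (E x)

record IsFiniteBorelEquivalence (X : StandardBorelSpace) (F : Rel (Carrier X) 0ℓ) : Set₁ where
  field
    isEquivalence : IsEquivalence F
    isBorel       : BorelRel X F
    isFinite      : ∀ x → Finite (F x)

record IsHyperfinite (X : StandardBorelSpace) (E : Rel (Carrier X) 0ℓ) : Set₁ where
  field
    isEquivalence : IsEquivalence E
    isBorel       : BorelRel X E
    F             : ℕ → Rel (Carrier X) 0ℓ
    F-finite      : ∀ i → IsFiniteBorelEquivalence X (F i)
    F-increasing  : ∀ i → F i ⇒ F (suc i)
    E-union       : ∀ {x y} → E x y ⇔ (∃[ i ] F i x y)

E₁ : {X : Set} → Rel (ℕ → X) 0ℓ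
E₁ u v = ∃[ i ] (∀ j → i ≤ j → u j ≡ v j)

Saturation : {X : Set} → Rel X 0ℓ → Pred X 0ℓ → Pred X 0ℓ
Saturation E A y = ∃[ x ] (x ∈ A × E x y)

-- InClass E n A says A ∈ [X]ⁿ_E.
InClass : {X : Set} → Rel X 0ℓ → ℕ → Pred X 0ℓ → Set
InClass E n A = HasSize n A × ∃[ x ] (A ⊆ E x)

record Coloring {X : Set} (E : Rel X 0ℓ) (n k : ℕ) : Set₁ where
  field
    color      : (A : Pred X 0ℓ) → InClass E n A → Fin k
    color-cong : ∀ {A B} (a : InClass E n A) (b : InClass E n B) →
                 A ≐ B → color A a ≡ color B b

open Coloring public using (color)

-- The tuples corresponding to elements of [X]ⁿ_E when these are listed in
-- increasing order.
IncreasingTuple : {X : Set} → Rel X 0ℓ → Rel X 0ℓ → (n : ℕ) → Pred (Vec X n) 0ℓ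
IncreasingTuple _<_ E n v = AllPairs _<_ v × ∃[ x ] All (E x) v

module _ (X : StandardBorelSpace)
         {_<_ : Rel (Carrier X) 0ℓ} (ord : IsBorelLinearOrder X _<_)
         {E : Rel (Carrier X) 0ℓ} {n k : ℕ} where

  tupleInClass : (t : ∃ (IncreasingTuple _<_ E n)) → InClass E n (_∈ᵛ proj₁ t)
  tupleInClass (v , increasing , x , inClass) =
    (v , AllPairs.map <⇒≢ increasing , id , id) , x , All.lookup inClass
    where
    open IsStrictTotalOrder (IsBorelLinearOrder.isStrictTotalOrder ord) using (irrefl)
    <⇒≢ : ∀ {x y} → x < y → x ≢ y
    <⇒≢ x<y x≡y = irrefl x≡y x<y

  -- [X]ⁿ_E carries the Borel structure of the subspace of increasing tuples
  -- in Xⁿ.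
  IsBorelColoring : Coloring E n k → Set₁
  IsBorelColoring c =
    IsMeasurableMap (subspace (power (borel X) n) (IncreasingTuple _<_ E n))
                    (discrete (Fin k))
                    (λ t → color c (_∈ᵛ proj₁ t) (tupleInClass t))

module _ {X : Set} {E : Rel X 0ℓ} (isEq : IsEquivalence E) where

  insert-inClass : ∀ {n m} .{{_ : NonZero n}} {A B : Pred X 0ℓ} {z} →
    InClass E m A → HasSize (pred n) B → B ⊆ A →
    z ∈ Saturation E A → z ∉ B → InClass E n (｛ z ｝ ∪ B)
  insert-inClass {suc n} {B = B} {z} (_ , x , A⊆[x]) (v , unique , B⊆v , v⊆B) B⊆A (a , a∈A , aEz) z∉B =
    (z ∷ v , (lookup⁻ z≢ ∷ unique) , to , from) , x , inClass
    where
    z≢ : ∀ i → z ≢ lookup v i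
    z≢ i refl = z∉B (v⊆B (∈-lookup i v))
    to : ｛ z ｝ ∪ B ⊆ (_∈ᵛ (z ∷ v))
    to (inj₁ z≡y) = here (sym z≡y)
    to (inj₂ y∈B) = there (B⊆v y∈B)
    from : (_∈ᵛ (z ∷ v)) ⊆ ｛ z ｝ ∪ B
    from (here y≡z)  = inj₁ (sym y≡z)
    from (there y∈v) = inj₂ (v⊆B y∈v)
    inClass : ｛ z ｝ ∪ B ⊆ E x
    inClass (inj₁ refl) = IsEquivalence.trans isEq (A⊆[x] a∈A) aEz
    inClass (inj₂ y∈B)  = A⊆[x] (B⊆A y∈B)

  AlmostTransitive : ∀ {n k} .{{_ : NonZero n}} → Coloring E n k → Set₁
  AlmostTransitive {n} c =
    (m : ℕ) → n ≤ m → (A : Pred X 0ℓ) (A∈ : InClass E m A) →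
    (B₁ B₂ : Pred X 0ℓ)
    (size₁ : HasSize (pred n) B₁) (B₁⊆A : B₁ ⊆ A)
    (size₂ : HasSize (pred n) B₂) (B₂⊆A : B₂ ⊆ A) →
    Finite λ z →
      Σ[ z∈[A] ∈ z ∈ Saturation E A ] Σ[ z∉B₁ ∈ z ∉ B₁ ] Σ[ z∉B₂ ∈ z ∉ B₂ ]
        (color c (｛ z ｝ ∪ B₁) (insert-inClass A∈ size₁ B₁⊆A z∈[A] z∉B₁)
         ≢ color c (｛ z ｝ ∪ B₂) (insert-inClass A∈ size₂ B₂⊆A z∈[A] z∉B₂))

record MonochromaticIn {X : Set} {E : Rel X 0ℓ} {n k : ℕ}
                       (c : Coloring E n k) (x : X) (M : Pred X 0ℓ) : Set₁ where
  field
    inClass  : M ⊆ E x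
    constant : (A B : Pred X 0ℓ) (sizeA : HasSize n A) (sizeB : HasSize n B)
               (A⊆M : A ⊆ M) (B⊆M : B ⊆ M) →
               color c A (sizeA , x , inClass ∘ A⊆M) ≡ color c B (sizeB , x , inClass ∘ B⊆M)

range : {X : Set} → (ℕ → X) → Pred X 0ℓ
range u y = ∃[ i ] u i ≡ y

record IsMonochromaticReduction {X : Set} {E : Rel X 0ℓ} {n k : ℕ}
                                (c : Coloring E n k) (S : X → (ℕ → X)) : Set₁ where
  field
    distinct      : ∀ x {i j} → i ≢ j → S x i ≢ S x j
    monochromatic : ∀ x → MonochromaticIn c x (range (S x))
    reduction     : ∀ x y → E x y ⇔ E₁ (S x) (S y)

{-# OPTIONS --safe #-}
module Submission where

-- Descriptive part.  A point is coded by the set of basic balls containing it,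
-- which turns Borel sets into projections of closed subsets of Baire space.
-- For a finite Borel equivalence relation F, let W n be the set of x whose class
-- has two points in a common ball of radius 1/(n+1).  The W n are analytic with
-- empty intersection, so Novikov's theorem gives Borel V n ⊇ W n with empty
-- intersection.  Off V n, the points of a class are told apart by the balls of
-- level n; hence F is covered by countably many functional analytic sets, and
-- these extend to Borel maps by separation.  So there are Borel maps g j with
-- [x]_E ⊆ {g j x : j}, and quantifiers over classes preserve Borelness.
--
-- Combinatorial part.  By almost transitivity, every class has a colour r such
-- that for each finite subset A of the class some w ∉ A in the class satisfies
-- c({w} ∪ B) = r for all B ∈ [A]ⁿ⁻¹; the least such r depends only on the class.
-- Define u k recursively: u k x is chosen in this way from the least element of
-- [x]_{F k}, with A ⊇ {u j z : j < k, z ∈ [x]_{F k}}.  Then u k is constant on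
-- F k-classes, and S x k = u k x works: a finite subset of the sequence has
-- colour r by the choice of its last entry.

open import Defs
open import Axiom.ExcludedMiddle using (ExcludedMiddle)
open import Data.Bool.Base using (Bool; true; false; if_then_else_)
open import Data.Empty using (⊥; ⊥-elim)
open import Data.Fin.Base as Fin using (Fin; zero; suc; toℕ)
import Data.Fin.Properties as Fin
open import Data.Integer.Base as ℤ using (+<+; +[1+_])
open import Data.List.Base as List using (List; []; _∷_; _++_)
open import Data.List.Membership.Propositional using () renaming (_∈_ to _∈ˡ_)
open import Data.List.Membership.Propositional.Properties using (∈-++⁺ˡ; ∈-++⁺ʳ; ∈-allFin; ∈-map⁺)
open import Data.List.Relation.Unary.All as ListAll using ([]; _∷_) renaming (All to Allˡ)
import Data.List.Relation.Unary.All.Properties as ListAll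
open import Data.List.Relation.Unary.Any using (here; there)
open import Data.Maybe.Base using (just)
open import Data.Maybe.Properties using (just-injective)
open import Data.Nat.Base as ℕ using (ℕ; zero; suc; NonZero; _≤_; _⊔_; s≤s)
open import Data.Nat.Coprimality using (1-coprimeTo)
open import Data.Nat.Induction using (<-wellFounded)
import Data.Nat.Properties as ℕ
open import Data.Product.Base using (Σ; Σ-syntax; ∃; ∃-syntax; _×_; _,_; proj₁; proj₂; uncurry)
open import Data.Rational.Base as ℚ using (ℚ; 0ℚ; mkℚ; ½; *<*)
import Data.Rational.Properties as ℚ
open import Data.Sum.Base using (_⊎_; inj₁; inj₂; [_,_])
open import Data.Vec.Base as Vec using (Vec; []; _∷_; lookup)
open import Data.Vec.Membership.Propositional using () renaming (_∈_ to _∈ᵛ_; _∉_ to _∉ᵛ_)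
open import Data.Vec.Properties using (lookup-map)
open import Data.Vec.Relation.Unary.All as All using (All; []; _∷_)
open import Data.Vec.Relation.Unary.AllPairs as AllPairs using (AllPairs; []; _∷_)
open import Data.Vec.Relation.Unary.Any using (here; there)
open import Data.Vec.Relation.Unary.Unique.Propositional using (Unique)
open import Function.Base using (_∘_; id)
open import Function.Bundles using (_⇔_; mk⇔; Equivalence)
open import Induction.WellFounded using (Acc; acc)
open import Level using (Level; 0ℓ)
open import Relation.Binary.Core using (Rel)
open import Relation.Binary.Definitions using (Tri; tri<; tri≈; tri>)
open import Relation.Binary.PropositionalEquality
  using (_≡_; _≢_; refl; sym; trans; cong; cong₂; subst)
open import Relation.Binary.Structures using (IsEquivalence; IsStrictTotalOrder)
open import Relation.Nullary using (¬_; Dec; yes; no)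
open import Relation.Nullary.Decidable using (decidable-stable)
open import Relation.Unary
  using (Pred; _∈_; _∉_; _⊆_; _≐_; _⊢_; ∁; ⋃; ⋂; U; ∅; _∩_; _∪_; ｛_｝; _⟨×⟩_)

private variable
  ℓ ℓ′ : Level
  I J K T Y Z : Set
  n : ℕ

module _ (em : ∀ {ℓ} → ExcludedMiddle ℓ) where

  -- Classical logic and countable index sets

  byContradiction : {P : Set ℓ} → ¬ ¬ P → P
  byContradiction = decidable-stable em

  ¬∀⇒∃¬ : {A : Set ℓ} {P : A → Set ℓ′} → ¬ (∀ a → P a) → ∃[ a ] ¬ P a
  ¬∀⇒∃¬ ¬∀ = byContradiction λ ¬∃ → ¬∀ λ a → byContradiction λ ¬p → ¬∃ (a , ¬p)

  -- A surjection from ℕ makes countable sets inhabited. Among the sets `Fin n` only the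
  -- `Fin (suc n)` are countable in this sense, and the empty case is treated separately where it
  -- occurs.
  Countable : Set → Set
  Countable I = Σ[ e ∈ (ℕ → I) ] (∀ i → ∃[ n ] e n ≡ i)

  -- The antidiagonals (0,b), …, (b,0) are traversed one after the other.
  unpair : ℕ → ℕ × ℕ
  unpair zero = 0 , 0
  unpair (suc n) with unpair n
  ... | a , zero  = 0 , suc a
  ... | a , suc b = suc a , b

  unpair-surjective : ∀ p → ∃[ n ] unpair n ≡ p
  unpair-surjective (a , b) = onDiagonal (a ℕ.+ b) a b refl
    where
    onDiagonal : ∀ s a b → a ℕ.+ b ≡ s → ∃[ n ] unpair n ≡ (a , b)
    onDiagonal zero zero zero refl = 0 , refl
    onDiagonal (suc s) zero .(suc s) refl with onDiagonal s s zero (ℕ.+-identityʳ s)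
    ... | n , eq = suc n , next
      where
      next : unpair (suc n) ≡ (0 , suc s)
      next rewrite eq = refl
    onDiagonal s (suc a) b eq with onDiagonal s a (suc b) (trans (ℕ.+-suc a b) eq)
    ... | n , eq′ = suc n , next
      where
      next : unpair (suc n) ≡ (suc a , b)
      next rewrite eq′ = refl

  surject : (f : I → J) → (∀ j → ∃[ i ] f i ≡ j) → Countable I → Countable J
  surject f f-onto (e , e-onto) = f ∘ e , λ j →
    let (i , fi≡j) = f-onto j ; (n , en≡i) = e-onto i
    in n , trans (cong f en≡i) fi≡j

  countable-ℕ : Countable ℕ
  countable-ℕ = id , λ n → n , refl

  abstract
    countable-Σ : {B : I → Set} → Countable I → (∀ i → Countable (B i)) → Countable (Σ I B)
    countable-Σ {I} {B} (e , e-onto) cB = enumerate , λ (i , y) → onto i y (e-onto i)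
      where
      entry : ℕ × ℕ → Σ I B
      entry (a , b) = e a , proj₁ (cB (e a)) b
      enumerate : ℕ → Σ I B
      enumerate n = entry (unpair n)
      onto : ∀ i y → ∃[ a ] e a ≡ i → ∃[ n ] enumerate n ≡ (i , y)
      onto _ y (a , refl) =
        let (b , eq) = proj₂ (cB (e a)) y ; (n , eq′) = unpair-surjective (a , b)
        in n , trans (cong entry eq′) (cong (e a ,_) eq)

  countable-× : Countable I → Countable J → Countable (I × J)
  countable-× cI cJ = countable-Σ cI λ _ → cJ

  countable-Bool : Countable Bool
  countable-Bool = (λ { zero → true ; (suc _) → false }) , λ { true → 0 , refl ; false → 1 , refl }

  countable-⊎ : Countable I → Countable J → Countable (I ⊎ J)
  countable-⊎ {I} {J} cI cJ = surject {I = Σ Bool (λ b → if b then I else J)}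
    (λ { (true , i) → inj₁ i ; (false , j) → inj₂ j })
    (λ { (inj₁ i) → (true , i) , refl ; (inj₂ j) → (false , j) , refl })
    (countable-Σ countable-Bool λ { true → cI ; false → cJ })

  countable-Vec : Countable I → ∀ n → Countable (Vec I n)
  countable-Vec cI zero    = (λ _ → []) , λ { [] → 0 , refl }
  countable-Vec cI (suc n) =
    surject (uncurry _∷_) (λ { (x ∷ v) → (x , v) , refl }) (countable-× cI (countable-Vec cI n))

  countable-Fin : ∀ n → Countable (Fin (suc n))
  countable-Fin zero    = (λ _ → zero) , λ { zero → 0 , refl }
  countable-Fin (suc n) = surject
    (λ { (inj₁ _) → zero ; (inj₂ i) → suc i })
    (λ { zero → inj₁ 0 , refl ; (suc i) → inj₂ i , refl })
    (countable-⊎ countable-ℕ (countable-Fin n))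

  -- σ-algebras

  module _ (𝓑 : σ-Algebra T) where
    private
      module 𝓑 = σ-Algebra 𝓑
      M = Measurable 𝓑

    abstract
      -- Excluded middle makes the set either `U` or empty. Hence side conditions on indices, such
      -- as an inclusion between two balls, can occur freely in the formula of a measurable set.
      measurable-const : (P : Set) → M (λ _ → P)
      measurable-const P with em {P = P}
      ... | yes p = 𝓑.resp-≐ ((λ _ → p) , _) 𝓑.whole
      ... | no ¬p = 𝓑.resp-≐ ((λ ¬⊤ → ⊥-elim (¬⊤ _)) , λ p → ⊥-elim (¬p p)) (𝓑.complement 𝓑.whole)

      measurable-∃ : {A : I → Pred T 0ℓ} → Countable I → (∀ i → M (A i)) → M (λ x → ∃[ i ] A i x)
      measurable-∃ {A = A} (e , onto) MA = 𝓑.resp-≐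
        ((λ (n , a) → e n , a) , λ {x} (i , a) → let (n , eq) = onto i in n , subst (λ i → A i x) (sym eq) a)
        (𝓑.union {A = A ∘ e} (MA ∘ e))

      measurable-∀ : {A : I → Pred T 0ℓ} → Countable I → (∀ i → M (A i)) → M (λ x → ∀ i → A i x)
      measurable-∀ cI MA = 𝓑.resp-≐
        ((λ ¬∃ i → byContradiction λ ¬a → ¬∃ (i , ¬a)) , λ ∀a (i , ¬a) → ¬a (∀a i))
        (𝓑.complement (measurable-∃ cI (𝓑.complement ∘ MA)))

      measurable-× : {A B : Pred T 0ℓ} → M A → M B → M (λ x → A x × B x)
      measurable-× {A} {B} MA MB = 𝓑.resp-≐
        ((λ f → f true , f false) , λ (a , b) → λ { true → a ; false → b })
        (measurable-∀ {A = λ b → if b then A else B} countable-Bool λ { true → MA ; false → MB })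

      measurable-→ : {A B : Pred T 0ℓ} → M A → M B → M (λ x → A x → B x)
      measurable-→ MA MB = 𝓑.resp-≐
        ((λ h a → byContradiction λ ¬b → h (a , ¬b)) , λ f (a , ¬b) → ¬b (f a))
        (𝓑.complement (measurable-× MA (𝓑.complement MB)))

      measurable-⊎ : {A B : Pred T 0ℓ} → M A → M B → M (λ x → A x ⊎ B x)
      measurable-⊎ MA MB = 𝓑.resp-≐
        ( (λ f → byContradiction λ ¬⊎ → ¬⊎ (inj₂ (f (¬⊎ ∘ inj₁))))
        , λ { (inj₁ a) ¬a → ⊥-elim (¬a a) ; (inj₂ b) _ → b })
        (measurable-→ (𝓑.complement MA) MB)

  module _ (𝓐 : σ-Algebra Y) (𝓑 : σ-Algebra T) (f : I → Z → T) where

    abstract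
      -- The sets whose preimage under `h` is measurable form a σ-algebra that contains the
      -- generators.
      initial-universal : (h : Y → Z) → (∀ i → IsMeasurableMap 𝓐 𝓑 (f i ∘ h)) →
                          IsMeasurableMap 𝓐 (initial 𝓑 f) h
      initial-universal h fh-measurable _ = go
        where
        open σ-Algebra 𝓐 using () renaming (resp-≐ to respA; whole to wholeA; complement to complA; union to unionA)
        go : ∀ {A} → Measurable (initial 𝓑 f) A → Measurable 𝓐 (h ⊢ A)
        go (basic (i , B , MB , (to , from))) = respA (from , to) (fh-measurable i B MB)
        go (resp-≐ (to , from) MA)            = respA (to , from) (go MA)
        go whole                              = wholeA
        go (complement MA)                    = complA (go MA)
        go (union MA)                         = unionA λ i → go (MA i)

  pair-measurable : {𝓐 : σ-Algebra Y} {𝓑 : σ-Algebra T} {f g : Y → T} →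
    IsMeasurableMap 𝓐 𝓑 f → IsMeasurableMap 𝓐 𝓑 g → IsMeasurableMap 𝓐 (square 𝓑) (λ y → f y , g y)
  pair-measurable {𝓐 = 𝓐} {𝓑} f-meas g-meas =
    initial-universal 𝓐 𝓑 _ _ λ { true → f-meas ; false → g-meas }

  abstract
    -- The traces on `D` of measurable sets form a σ-algebra that contains the generators of the
    -- subspace structure.
    subspace-trace : (𝓑 : σ-Algebra T) (D : Pred T 0ℓ) {A : Pred (∃ D) 0ℓ} →
      Measurable (subspace 𝓑 D) A → Σ[ B ∈ Pred T 0ℓ ] (Measurable 𝓑 B × A ≐ (proj₁ ⊢ B))
    subspace-trace 𝓑 D = go
      where
      module 𝓑 = σ-Algebra 𝓑
      go : ∀ {A} → Measurable (subspace 𝓑 D) A → Σ[ B ∈ Pred _ 0ℓ ] (Measurable 𝓑 B × A ≐ (proj₁ ⊢ B))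
      go (basic (_ , B , MB , A≐B)) = B , MB , A≐B
      go (resp-≐ (to , from) MA) with go MA
      ... | B , MB , (to′ , from′) = B , MB , (to′ ∘ from) , (to ∘ from′)
      go whole = U , 𝓑.whole , id , id
      go (complement MA) with go MA
      ... | B , MB , (to′ , from′) = ∁ B , 𝓑.complement MB , (λ ¬a → ¬a ∘ from′) , λ ¬b → ¬b ∘ to′
      go (union MA) =
        ⋃ ℕ (λ i → proj₁ (go (MA i))) , 𝓑.union (λ i → proj₁ (proj₂ (go (MA i)))) ,
        (λ (i , a) → i , proj₁ (proj₂ (proj₂ (go (MA i)))) a) ,
        (λ (i , b) → i , proj₂ (proj₂ (proj₂ (go (MA i)))) b)

  -- Analytic sets

  AgreeOn : List J → (J → ℕ) → (J → ℕ) → Set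
  AgreeOn L f g = Allˡ (λ j → f j ≡ g j) L

  -- Closedness in the product topology of discrete copies of ℕ: a basic neighbourhood of `f` fixes
  -- the values on a finite list of coordinates.
  Closed : Pred (J → ℕ) 0ℓ → Set
  Closed R = ∀ f → (∀ L → ∃[ g ] (R g × AgreeOn L g f)) → R f

  abstract
    closed-∀ : {A : Set} {R : A → Pred (J → ℕ) 0ℓ} → (∀ a → Closed (R a)) → Closed (λ f → ∀ a → R a f)
    closed-∀ closed f approx a = closed a f λ L → let (g , Rg , g≗f) = approx L in g , Rg a , g≗f

    closed-× : {R S : Pred (J → ℕ) 0ℓ} → Closed R → Closed S → Closed (λ f → R f × S f)
    closed-× closedR closedS f approx =
      closedR f (λ L → let (g , (Rg , _) , g≗f) = approx L in g , Rg , g≗f) ,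
      closedS f (λ L → let (g , (_ , Sg) , g≗f) = approx L in g , Sg , g≗f)

    closed-∘ : {R : Pred (J → ℕ) 0ℓ} (p : J → K) → Closed R → Closed (λ f → R (f ∘ p))
    closed-∘ p closed f approx = closed (f ∘ p) λ L →
      let (g , Rg , g≗f) = approx (List.map p L) in g ∘ p , Rg , ListAll.map⁻ g≗f

    -- Read contrapositively, the hypothesis says that a failure of `R` at `f` spreads to the
    -- neighbourhood fixed by `L`, so the complement is open. The list may depend on `f`, which
    -- allows conditions whose relevant coordinates are themselves given by values of `f`.
    closed-local : {R : Pred (J → ℕ) 0ℓ} →
      (∀ f → ∃[ L ] (∀ g → AgreeOn L g f → R g → R f)) → Closed R
    closed-local local f approx =
      let (L , Rg⇒Rf) = local f ; (g , Rg , g≗f) = approx L in Rg⇒Rf g g≗f Rg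

    closed-≡ : (i j : J) → Closed (λ f → f i ≡ f j)
    closed-≡ i j = closed-local λ f → i ∷ j ∷ [] , λ { g (gi ∷ gj ∷ []) eq → trans (sym gi) (trans eq gj) }

  -- A is the projection of a closed subset of Baire space ℕᴶ, where a point z is
  -- represented in ℕᴶ by its code κ z, read off at the coordinates given by place.
  record Analytic (κ : Z → I → ℕ) (A : Pred Z 0ℓ) : Set₁ where
    field
      Index     : Set
      countable : Countable Index
      place     : I → Index
      Body      : Pred (Index → ℕ) 0ℓ
      closed    : Closed Body
      sound     : ∀ {f} → Body f → ∃[ z ] (z ∈ A × ∀ i → f (place i) ≡ κ z i)
      complete  : ∀ {z} → z ∈ A → ∃[ f ] (Body f × ∀ i → f (place i) ≡ κ z i)

  Faithful : (Z → I → ℕ) → Set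
  Faithful κ = ∀ {z z′} → (∀ i → κ z i ≡ κ z′ i) → z ≡ z′

  infixr 5 _⊗_
  _⊗_ : (T → I → ℕ) → (Y → J → ℕ) → (T × Y → I ⊎ J → ℕ)
  (κ ⊗ μ) (x , y) = [ κ x , μ y ]

  ⊗-faithful : {κ : T → I → ℕ} {μ : Y → J → ℕ} → Faithful κ → Faithful μ → Faithful (κ ⊗ μ)
  ⊗-faithful κ-faithful μ-faithful eq = cong₂ _,_ (κ-faithful (eq ∘ inj₁)) (μ-faithful (eq ∘ inj₂))

  module _ {κ : Z → I → ℕ} where

    abstract
      analytic-≐ : {A B : Pred Z 0ℓ} → A ≐ B → Analytic κ A → Analytic κ B
      analytic-≐ (to , from) 𝒜 = record
        { Analytic 𝒜
        ; sound    = λ Rf → let (z , z∈A , eq) = Analytic.sound 𝒜 Rf in z , to z∈A , eq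
        ; complete = Analytic.complete 𝒜 ∘ from
        }

      analytic-∅ : Countable I → Analytic κ ∅
      analytic-∅ cI = record
        { Index = I ; countable = cI ; place = id ; Body = ∅
        ; closed = λ f approx → proj₁ (proj₂ (approx []))
        ; sound = λ () ; complete = λ () }

      -- A witness is a sequence of witnesses, one for each set, whose code coordinates agree. By
      -- faithfulness the points that they represent coincide.
      analytic-⋂ : Faithful κ → {A : ℕ → Pred Z 0ℓ} → (∀ n → Analytic κ (A n)) → Analytic κ (⋂ ℕ A)
      analytic-⋂ faithful {A} 𝒜 = record
        { Index     = Σ ℕ λ n → 𝒜.Index n
        ; countable = countable-Σ countable-ℕ λ n → 𝒜.countable n
        ; place     = λ i → 0 , 𝒜.place 0 i
        ; Body      = Body
        ; closed    = closed-× (closed-∀ λ n → closed-∘ (n ,_) (𝒜.closed n))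
                               (closed-∀ λ n → closed-∀ λ i → closed-≡ _ _)
        ; sound     = sound
        ; complete  = λ z∈A →
            (λ (n , j) → proj₁ (𝒜.complete n (z∈A n)) j) ,
            ((λ n → proj₁ (proj₂ (𝒜.complete n (z∈A n)))) ,
             λ n i → trans (proj₂ (proj₂ (𝒜.complete n (z∈A n))) i) (sym (proj₂ (proj₂ (𝒜.complete 0 (z∈A 0))) i))) ,
            proj₂ (proj₂ (𝒜.complete 0 (z∈A 0)))
        }
        where
        module 𝒜 n = Analytic (𝒜 n)
        Body : Pred (Σ ℕ (λ n → 𝒜.Index n) → ℕ) 0ℓ
        Body f = (∀ n → 𝒜.Body n (f ∘ (n ,_))) × (∀ n i → f (n , 𝒜.place n i) ≡ f (0 , 𝒜.place 0 i))
        sound : ∀ {f} → Body f → ∃[ z ] (z ∈ ⋂ ℕ A × ∀ i → f (0 , 𝒜.place 0 i) ≡ κ z i)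
        sound (bodies , same) with 𝒜.sound 0 (bodies 0)
        ... | z , _ , eq = z , (λ n → let (zₙ , zₙ∈A , eqₙ) = 𝒜.sound n (bodies n) in
                                  subst (_∈ A n) (faithful λ i → trans (sym (eqₙ i)) (trans (same n i) (eq i))) zₙ∈A) , eq

      -- A witness stores the number of a set at `choice`, a copy of the code at `point`, and room
      -- for a witness for every set; only the branch named by `choice` is constrained.
      analytic-⋃ : Countable I → {A : ℕ → Pred Z 0ℓ} → (∀ n → Analytic κ (A n)) → Analytic κ (⋃ ℕ A)
      analytic-⋃ cI {A} 𝒜 = record
        { Index     = Index
        ; countable = countable-⊎ countable-ℕ
                                  (countable-⊎ cI (countable-Σ countable-ℕ λ n → 𝒜.countable n))
        ; place     = point
        ; Body      = Body
        ; closed    = closed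
        ; sound     = λ {f} (Rf , same) → let (z , z∈A , eq) = 𝒜.sound (f choice) Rf in
                        z , (f choice , z∈A) , λ i → trans (same i) (eq i)
        ; complete  = complete
        }
        where
        module 𝒜 n = Analytic (𝒜 n)
        Index : Set
        Index = ℕ ⊎ (I ⊎ Σ ℕ (λ n → 𝒜.Index n))
        choice : Index
        choice = inj₁ 0
        point : I → Index
        point i = inj₂ (inj₁ i)
        branch : ∀ n → 𝒜.Index n → Index
        branch n j = inj₂ (inj₂ (n , j))
        Fibre : ℕ → Pred (Index → ℕ) 0ℓ
        Fibre n f = 𝒜.Body n (f ∘ branch n) × (∀ i → f (point i) ≡ f (branch n (𝒜.place n i)))
        Body : Pred (Index → ℕ) 0ℓ
        Body f = Fibre (f choice) f
        closed-fibre : ∀ n → Closed (Fibre n)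
        closed-fibre n = closed-× (closed-∘ (branch n) (𝒜.closed n)) (closed-∀ λ i → closed-≡ _ _)
        closed : Closed Body
        closed f approx = closed-fibre (f choice) f approx′
          where
          approx′ : ∀ L → ∃[ g ] (Fibre (f choice) g × AgreeOn L g f)
          -- With `choice` in the list, every approximant lies in the same fibre as `f`.
          approx′ L with approx (choice ∷ L)
          ... | g , Rg , (eq ∷ g≗f) = g , subst (λ n → Fibre n g) eq Rg , g≗f
        complete : ∀ {z} → z ∈ ⋃ ℕ A → ∃[ f ] (Body f × ∀ i → f (point i) ≡ κ z i)
        complete {z} (n , z∈A) with 𝒜.complete n z∈A
        ... | g , Rg , eq = f , (extended-body , sym ∘ extended-point) , λ _ → refl
          where
          extended : ∀ {m} → Dec (n ≡ m) → 𝒜.Index m → ℕ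
          extended (yes refl) = g
          -- A default: the branches other than `n` are unconstrained.
          extended (no _) _   = 0
          f : Index → ℕ
          f (inj₁ _)              = n
          f (inj₂ (inj₁ i))       = κ z i
          f (inj₂ (inj₂ (m , j))) = extended (n ℕ.≟ m) j
          extended-body : 𝒜.Body n (extended (n ℕ.≟ n))
          extended-body with n ℕ.≟ n
          ... | yes refl = Rg
          ... | no n≢n   = ⊥-elim (n≢n refl)
          extended-point : ∀ i → extended (n ℕ.≟ n) (𝒜.place n i) ≡ κ z i
          extended-point with n ℕ.≟ n
          ... | yes refl = eq
          ... | no n≢n   = ⊥-elim (n≢n refl)

      analytic-∩ : Faithful κ → {A B : Pred Z 0ℓ} → Analytic κ A → Analytic κ B → Analytic κ (A ∩ B)
      analytic-∩ faithful {A} {B} 𝒜 ℬ = analytic-≐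
        ((λ z∈ → z∈ 0 , z∈ 1) , λ { (a , b) zero → a ; (a , b) (suc _) → b })
        (analytic-⋂ faithful {λ { zero → A ; (suc _) → B }} λ { zero → 𝒜 ; (suc _) → ℬ })

      analytic-∃ : Countable I → Countable J → {A : J → Pred Z 0ℓ} → (∀ j → Analytic κ (A j)) →
                   Analytic κ (λ z → ∃[ j ] A j z)
      analytic-∃ cI (e , onto) {A} 𝒜 = analytic-≐
        ((λ (n , a) → e n , a) , λ {z} (j , a) → let (n , eq) = onto j in n , subst (λ j → A j z) (sym eq) a)
        (analytic-⋃ cI (𝒜 ∘ e))

  abstract
    analytic-⟨×⟩ : {κ : T → I → ℕ} {μ : Y → J → ℕ} {A : Pred T 0ℓ} {B : Pred Y 0ℓ} →
      Analytic κ A → Analytic μ B → Analytic (κ ⊗ μ) (A ⟨×⟩ B)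
    analytic-⟨×⟩ 𝒜 ℬ = record
      { Index     = 𝒜.Index ⊎ ℬ.Index
      ; countable = countable-⊎ 𝒜.countable ℬ.countable
      ; place     = λ { (inj₁ i) → inj₁ (𝒜.place i) ; (inj₂ j) → inj₂ (ℬ.place j) }
      ; Body      = λ f → 𝒜.Body (f ∘ inj₁) × ℬ.Body (f ∘ inj₂)
      ; closed    = closed-× (closed-∘ inj₁ 𝒜.closed) (closed-∘ inj₂ ℬ.closed)
      ; sound     = λ (Rf , Sf) →
          let (x , x∈A , eq) = 𝒜.sound Rf ; (y , y∈B , eq′) = ℬ.sound Sf
          in (x , y) , (x∈A , y∈B) , λ { (inj₁ i) → eq i ; (inj₂ j) → eq′ j }
      ; complete  = λ (x∈A , y∈B) →
          let (f , Rf , eq) = 𝒜.complete x∈A ; (g , Sg , eq′) = ℬ.complete y∈B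
          in [ f , g ] , (Rf , Sg) , λ { (inj₁ i) → eq i ; (inj₂ j) → eq′ j }
      }
      where
      module 𝒜 = Analytic 𝒜
      module ℬ = Analytic ℬ

    -- The closed set stays the same; the coordinates that code the second point become part of the
    -- hidden witness.
    analytic-proj : {κ : T → I → ℕ} {μ : Y → J → ℕ} {A : Pred (T × Y) 0ℓ} →
      Analytic (κ ⊗ μ) A → Analytic κ (λ x → ∃[ y ] A (x , y))
    analytic-proj 𝒜 = record
      { Analytic 𝒜
      ; place    = place ∘ inj₁
      ; sound    = λ Rf → let ((x , y) , xy∈A , eq) = sound Rf in x , (y , xy∈A) , eq ∘ inj₁
      ; complete = λ (y , xy∈A) → let (f , Rf , eq) = complete xy∈A in f , Rf , eq ∘ inj₁
      }
      where open Analytic 𝒜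

  BiAnalytic : (Z → I → ℕ) → Pred Z 0ℓ → Set₁
  BiAnalytic κ A = Analytic κ A × Analytic κ (∁ A)

  ∁∁-≐ : {A : Pred Z 0ℓ} → A ≐ ∁ (∁ A)
  ∁∁-≐ = (λ a ¬a → ¬a a) , byContradiction

  abstract
    -- The sets that are analytic together with their complements form a σ-algebra: complementation
    -- exchanges the two halves, and a union needs analytic unions for one half and analytic
    -- intersections for the other.
    generated-biAnalytic : {κ : Z → I → ℕ} → Faithful κ → Countable I → Analytic κ U →
      {G : Pred Z 0ℓ → Set ℓ} → (∀ {A} → G A → BiAnalytic κ A) → ∀ {A} → Generated G A → BiAnalytic κ A
    generated-biAnalytic {κ = κ} faithful cI 𝒰 {G} basic-biAnalytic = go
      where
      go : ∀ {A} → Generated G A → BiAnalytic κ A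
      go (basic g) = basic-biAnalytic g
      go (resp-≐ (to , from) 𝒜) with go 𝒜
      ... | pos , neg = analytic-≐ (to , from) pos , analytic-≐ ((λ ¬a → ¬a ∘ from) , λ ¬b → ¬b ∘ to) neg
      go whole = 𝒰 , analytic-≐ ((λ ()) , λ ¬⊤ → ¬⊤ _) (analytic-∅ cI)
      go (complement 𝒜) with go 𝒜
      ... | pos , neg = neg , analytic-≐ ∁∁-≐ pos
      go (union 𝒜) =
        analytic-⋃ cI (proj₁ ∘ go ∘ 𝒜) ,
        analytic-≐ ((λ ∀¬ (n , a) → ∀¬ n a) , λ ¬∃ n a → ¬∃ (n , a)) (analytic-⋂ faithful (proj₂ ∘ go ∘ 𝒜))

  -- Novikov separation

  Separated : σ-Algebra T → (ℕ → Pred T 0ℓ) → Set₁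
  Separated {T} 𝓑 A = Σ[ B ∈ (ℕ → Pred T 0ℓ) ]
    ((∀ n → Measurable 𝓑 (B n)) × (∀ n → A n ⊆ B n) × (∀ x → ∃[ n ] x ∉ B n))

  module _ (𝓑 : σ-Algebra T) {κ : T → I → ℕ} (faithful : Faithful κ)
           (κ-measurable : ∀ i v → Measurable 𝓑 (λ x → κ x i ≡ v))
           {A : ℕ → Pred T 0ℓ} (𝒜 : ∀ n → Analytic κ (A n)) where

    private
      module 𝒜 n = Analytic (𝒜 n)

      Coordinate : Set
      Coordinate = Σ ℕ λ n → 𝒜.Index n

      State : Set
      State = List (Coordinate × ℕ)

      -- A state fixes finitely many coordinates of the witnesses; those of the
      -- n-th component only concern the n-th set.
      Piece : State → ℕ → Pred T 0ℓ
      Piece s n x = ∃[ f ] (𝒜.Body n f × (∀ i → f (𝒜.place n i) ≡ κ x i) ×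
                            (∀ {j v} → ((n , j) , v) ∈ˡ s → f j ≡ v))

      -- The coordinate `c` belongs to the set with number `n₀` alone. Fixing its value splits the
      -- piece with that number into a union and leaves the other pieces unchanged, so the
      -- separating sets are joined over `v` at `n₀` and intersected over `v` elsewhere. A point in
      -- all of them would lie, for a single `v`, in every `Bᵛ v n`.
      separated-step : ∀ s c → (∀ v → Separated 𝓑 (Piece ((c , v) ∷ s))) → Separated 𝓑 (Piece s)
      separated-step s c@(n₀ , j₀) sep = B , B-measurable , B-contains , B-empty
        where
        Bᵛ : ℕ → ℕ → Pred T 0ℓ
        Bᵛ v = proj₁ (sep v)
        B : ℕ → Pred T 0ℓ
        B n x = (n ≡ n₀ × ∃[ v ] Bᵛ v n x) ⊎ (n ≢ n₀ × ∀ v → Bᵛ v n x)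
        B-measurable : ∀ n → Measurable 𝓑 (B n)
        B-measurable n = measurable-⊎ 𝓑
          (measurable-× 𝓑 (measurable-const 𝓑 _) (measurable-∃ 𝓑 countable-ℕ λ v → proj₁ (proj₂ (sep v)) n))
          (measurable-× 𝓑 (measurable-const 𝓑 _) (measurable-∀ 𝓑 countable-ℕ λ v → proj₁ (proj₂ (sep v)) n))
        B-contains : ∀ n → Piece s n ⊆ B n
        B-contains n (f , Rf , point , agree) with n ℕ.≟ n₀
        ... | yes refl = inj₁ (refl , f j₀ , proj₁ (proj₂ (proj₂ (sep (f j₀)))) n
                (f , Rf , point , λ { (here refl) → refl ; (there c∈s) → agree c∈s }))
        ... | no n≢n₀  = inj₂ (n≢n₀ , λ v → proj₁ (proj₂ (proj₂ (sep v))) n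
                (f , Rf , point , λ { (here refl) → ⊥-elim (n≢n₀ refl) ; (there c∈s) → agree c∈s }))
        B-empty : ∀ x → ∃[ n ] x ∉ B n
        B-empty x = ¬∀⇒∃¬ λ x∈B → contradicts x∈B (x∈B n₀)
          where
          contradicts : (∀ n → B n x) → B n₀ x → ⊥
          contradicts x∈B (inj₂ (n₀≢n₀ , _)) = n₀≢n₀ refl
          contradicts x∈B (inj₁ (_ , v , x∈Bᵛ)) = let (n , x∉) = proj₂ (proj₂ (proj₂ (sep v))) x in x∉ (inAll n (x∈B n))
            where
            inAll : ∀ n → B n x → Bᵛ v n x
            inAll n (inj₁ (refl , _)) = x∈Bᵛ
            inAll n (inj₂ (_ , all)) = all v

      coordinates : Countable Coordinate
      coordinates = countable-Σ countable-ℕ λ n → 𝒜.countable n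

      coordinate : ℕ → Coordinate
      coordinate = proj₁ coordinates

      indexOf : Coordinate → ℕ
      indexOf c = proj₁ (proj₂ coordinates c)

      -- An infinite chain of inseparable states determines witnesses for points
      -- of all the sets at once; the codes of these points cannot be told apart.
      module Limit (inseparable : ¬ Separated 𝓑 (Piece [])) (A-empty : ∀ x → ∃[ n ] x ∉ A n) where

        stage : ℕ → Σ[ s ∈ State ] ¬ Separated 𝓑 (Piece s)
        extend : ∀ m → ∃[ v ] ¬ Separated 𝓑 (Piece ((coordinate m , v) ∷ proj₁ (stage m)))
        stage zero    = [] , inseparable
        stage (suc m) = (coordinate m , proj₁ (extend m)) ∷ proj₁ (stage m) , proj₂ (extend m)
        extend m = ¬∀⇒∃¬ (proj₂ (stage m) ∘ separated-step (proj₁ (stage m)) (coordinate m))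

        state : ℕ → State
        state = proj₁ ∘ stage

        value : ℕ → ℕ
        value = proj₁ ∘ extend

        state-mono : ∀ {m m′} → m ≤ m′ → ∀ {cv} → cv ∈ˡ state m → cv ∈ˡ state m′
        state-mono m≤m′ = go (ℕ.≤⇒≤′ m≤m′)
          where
          go : ∀ {m m′} → m ℕ.≤′ m′ → ∀ {cv} → cv ∈ˡ state m → cv ∈ˡ state m′
          go ℕ.≤′-refl     ∈s = ∈s
          go (ℕ.≤′-step p) ∈s = there (go p ∈s)

        limit : Coordinate → ℕ
        limit c = value (indexOf c)

        limit∈state : ∀ c {m} → suc (indexOf c) ≤ m → (c , limit c) ∈ˡ state m
        limit∈state c i<m = state-mono i<m (here (cong (_, limit c) (sym (proj₂ (proj₂ coordinates c)))))

        piece-inhabited : ∀ m n → ∃ (Piece (state m) n)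
        piece-inhabited m n = byContradiction λ empty → proj₂ (stage m)
          -- If the piece with number `n` were empty, the empty set at `n` and the whole space
          -- elsewhere would separate the state.
          ( (λ n′ _ → n′ ≢ n) , (λ n′ → measurable-const 𝓑 _)
          , (λ { n′ {x} p refl → empty (x , p) })
          , λ x → n , λ n≢n → n≢n refl )

        bound : ∀ {n} (L : List (𝒜.Index n)) → ∃[ m ] Allˡ (λ j → suc (indexOf (n , j)) ≤ m) L
        bound []      = 0 , []
        bound {n} (j ∷ L) = let (m , below) = bound L in
          suc (indexOf (n , j)) ⊔ m , ℕ.m≤m⊔n _ m ∷ ListAll.map (λ p → ℕ.≤-trans p (ℕ.m≤n⊔m _ m)) below

        -- On a finite list of coordinates the limit agrees with a witness from an inhabited piece
        -- of a late enough stage, so closedness applies.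
        limit-body : ∀ n → 𝒜.Body n (limit ∘ (n ,_))
        limit-body n = 𝒜.closed n _ λ L →
          let (m , below) = bound L
              (x , f , Rf , _ , agree) = piece-inhabited m n
          in f , Rf , ListAll.map (λ {j} i<m → agree (limit∈state (n , j) i<m)) below

        point : ∀ n → ∃[ x ] (x ∈ A n × ∀ i → limit (n , 𝒜.place n i) ≡ κ x i)
        point n = 𝒜.sound n (limit-body n)

        -- If the codes differed at `i`, then at a stage `m` that has fixed both coordinates the
        -- pieces with numbers `n` and 0 would force different values of the code at `i`.
        -- Prescribing these values would separate the stage.
        same-code : ∀ n i → κ (proj₁ (point n)) i ≡ κ (proj₁ (point 0)) i
        same-code n i = byContradiction λ differ → proj₂ (stage m)
          ( B
          , (λ k → measurable-× 𝓑 (measurable-→ 𝓑 (measurable-const 𝓑 _) (κ-measurable i _))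
                                  (measurable-→ 𝓑 (measurable-const 𝓑 _) (κ-measurable i _)))
          , (λ k p → (λ { refl → piece-code k (ℕ.m≤m⊔n _ (suc (indexOf (0 , 𝒜.place 0 i)))) p })
                   , (λ { refl → piece-code 0 (ℕ.m≤n⊔m (suc (indexOf (n , 𝒜.place n i))) _) p }))
          , λ x → ¬∀⇒∃¬ λ all → differ (trans (sym (proj₁ (all n) refl)) (proj₂ (all 0) refl)) )
          where
          B : ℕ → Pred T 0ℓ
          B k x = (k ≡ n → κ x i ≡ κ (proj₁ (point n)) i) × (k ≡ 0 → κ x i ≡ κ (proj₁ (point 0)) i)
          m : ℕ
          m = suc (indexOf (n , 𝒜.place n i)) ⊔ suc (indexOf (0 , 𝒜.place 0 i))
          piece-code : ∀ k → suc (indexOf (k , 𝒜.place k i)) ≤ m → ∀ {x} → Piece (state m) k x →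
                       κ x i ≡ κ (proj₁ (point k)) i
          piece-code k i<m (f , _ , code , agree) =
            trans (sym (code i)) (trans (agree (limit∈state _ i<m)) (proj₂ (proj₂ (point k)) i))

        -- All the points coincide with `point 0`, which then lies in every `A n`.
        contradiction : ⊥
        contradiction = let (n , x₀∉A) = A-empty (proj₁ (point 0)) in
          x₀∉A (subst (_∈ A n) (faithful (same-code n)) (proj₁ (proj₂ (point n))))

    abstract
      novikov-separation : (∀ x → ∃[ n ] x ∉ A n) → Separated 𝓑 A
      novikov-separation A-empty =
        let (B , B-measurable , contains , B-empty) = byContradiction λ inseparable →
              Limit.contradiction inseparable A-empty
        in B , B-measurable ,
           (λ n x∈A → let (f , Rf , eq) = 𝒜.complete n x∈A in
             contains n (f , Rf , eq , λ ())) , B-empty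

  -- Coding the points of a Polish space by the balls containing them

  -- The rational 1/(m+1), since `mkℚ` takes the denominator minus one.
  ε : ℕ → ℚ
  ε m = mkℚ (ℤ.+ 1) m (1-coprimeTo (suc m))

  ε>0 : ∀ m → 0ℚ ℚ.< ε m
  ε>0 m = ℚ.positive⁻¹ (ε m)

  archimedean : ∀ {δ} → 0ℚ ℚ.< δ → ∃[ N ] (∀ {m} → N ≤ m → ε m ℚ.< δ)
  archimedean {mkℚ (ℤ.+ 0) d _} (*<* (+<+ ()))
  -- The inequality 1/(m+1) < (a+1)/(d+1) amounts to d+1 < (a+1)(m+1), for which d+1 ≤ m suffices.
  archimedean {mkℚ +[1+ a ] d _} _ = suc d , λ {m} d<m → *<* (+<+ (s≤s
    (ℕ.≤-trans (ℕ.≤-reflexive (cong suc (ℕ.+-identityʳ d))) (ℕ.≤-trans d<m (ℕ.m≤m+n m _)))))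
  archimedean {mkℚ (ℤ.-[1+ a ]) d _} (*<* ())

  halve : ∀ {δ} → 0ℚ ℚ.< δ → ∃[ η ] (0ℚ ℚ.< η × η ℚ.+ η ≡ δ)
  halve {δ} δ>0 = ½ ℚ.* δ ,
    ℚ.positive⁻¹ (½ ℚ.* δ) {{ℚ.pos*pos⇒pos ½ δ {{ℚ.positive δ>0}}}} ,
    trans (sym (ℚ.*-distribʳ-+ δ ½ ½)) (ℚ.*-identityˡ δ)

  ε+ε-small : ∀ {δ} → 0ℚ ℚ.< δ → ∃[ N ] (∀ {m} → N ≤ m → ε m ℚ.+ ε m ℚ.< δ)
  ε+ε-small δ>0 =
    let (η , η>0 , η+η≡δ) = halve δ>0 ; (N , small) = archimedean η>0
    in N , λ N≤m → subst (_ ℚ.<_) η+η≡δ (ℚ.+-mono-< (small N≤m) (small N≤m))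

  difference>0 : ∀ {p q} → p ℚ.< q → 0ℚ ℚ.< q ℚ.- p
  difference>0 {p} {q} p<q = subst (ℚ._< q ℚ.- p) (ℚ.+-inverseʳ p) (ℚ.+-monoˡ-< (ℚ.- p) p<q)

  p+[q-p]≡q : ∀ p q → p ℚ.+ (q ℚ.- p) ≡ q
  p+[q-p]≡q p q = trans (ℚ.+-comm p (q ℚ.- p)) (trans (ℚ.+-assoc q (ℚ.- p) p)
    (trans (cong (q ℚ.+_) (ℚ.+-inverseˡ p)) (ℚ.+-identityʳ q)))

  abstract
    indicator : Set → ℕ
    indicator P with em {P = P}
    ... | yes _ = 1
    ... | no _  = 0

    indicator≡1 : ∀ {P} → P → indicator P ≡ 1
    indicator≡1 {P} p with em {P = P}
    ... | yes _ = refl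
    ... | no ¬p = ⊥-elim (¬p p)

    indicator≡0 : ∀ {P} → ¬ P → indicator P ≡ 0
    indicator≡0 {P} ¬p with em {P = P}
    ... | yes p = ⊥-elim (¬p p)
    ... | no _  = refl

    indicator≡1⁻¹ : ∀ {P} → indicator P ≡ 1 → P
    indicator≡1⁻¹ {P} eq with em {P = P}
    indicator≡1⁻¹ eq  | yes p = p
    indicator≡1⁻¹ () | no _

    indicator-bit : ∀ P → indicator P ≡ 0 ⊎ indicator P ≡ 1
    indicator-bit P with em {P = P}
    ... | yes _ = inj₂ refl
    ... | no _  = inj₁ refl

    indicator-measurable : (𝓑 : σ-Algebra Y) {A : Pred Y 0ℓ} → Measurable 𝓑 A →
                           ∀ v → Measurable 𝓑 (λ y → indicator (A y) ≡ v)
    indicator-measurable 𝓑 {A} MA v = σ-Algebra.resp-≐ 𝓑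
      ( (λ { (inj₁ (a , eq)) → trans (indicator≡1 a) (sym eq) ; (inj₂ (¬a , eq)) → trans (indicator≡0 ¬a) (sym eq) })
      , cases)
      (measurable-⊎ 𝓑 (measurable-× 𝓑 MA (measurable-const 𝓑 (v ≡ 1)))
                      (measurable-× 𝓑 (σ-Algebra.complement 𝓑 MA) (measurable-const 𝓑 (v ≡ 0))))
      where
      cases : ∀ {y} → indicator (A y) ≡ v → (A y × v ≡ 1) ⊎ (¬ A y × v ≡ 0)
      cases {y} eq with em {P = A y}
      ... | yes a = inj₁ (a , sym eq)
      ... | no ¬a = inj₂ (¬a , sym eq)

  module _ (𝕏 : StandardBorelSpace) where
    open StandardBorelSpace 𝕏 using (metric; generates) renaming (Carrier to X; borel to 𝓑)
    open PolishMetric metric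

    Ball : ℕ × ℕ → Pred X 0ℓ
    Ball (i , m) x = ∃[ p ] (denseSeq i ≡ just p × d< p x (ε m))

    countable-balls : Countable (ℕ × ℕ)
    countable-balls = countable-× countable-ℕ countable-ℕ

    abstract
      ball-open : ∀ j → Open (Ball j)
      ball-open (i , m) (p , eq , px<ε) =
        -- Roundedness of the cut gives a `t` strictly below the radius, and the difference is left
        -- as a radius around `x`.
        let (t , t<ε , px<t) = rounded px<ε in
        ε m ℚ.- t , difference>0 t<ε , λ xy<ε-t → p , eq , subst (d< p _) (p+[q-p]≡q t (ε m)) (triangle px<t xy<ε-t)

      ball-measurable : ∀ j → Measurable 𝓑 (Ball j)
      ball-measurable j = Equivalence.from (generates _) (basic (ball-open j))

      ball-cover : ∀ m x → ∃[ i ] Ball (i , m) x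
      ball-cover m x = let (i , p , eq , px<ε) = dense x (ε>0 m) in i , p , eq , d-sym px<ε

      ball-diameter : ∀ {i m x y} → Ball (i , m) x → Ball (i , m) y → d< x y (ε m ℚ.+ ε m)
      ball-diameter (p , eq , px<ε) (q , eq′ , qy<ε) with just-injective (trans (sym eq) eq′)
      ... | refl = triangle (d-sym px<ε) qy<ε

      ball-within : ∀ {δ} → 0ℚ ℚ.< δ →
        ∃[ N ] (∀ {m} → N ≤ m → ∀ {i x y} → Ball (i , m) x → Ball (i , m) y → d< x y δ)
      ball-within δ>0 = let (N , small) = ε+ε-small δ>0 in
        N , λ N≤m x∈ y∈ → upward (small N≤m) (ball-diameter x∈ y∈)

      ball-base : ∀ {A} → Open A → ∀ {x} → x ∈ A → ∃[ j ] (Ball j x × Ball j ⊆ A)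
      ball-base A-open {x} x∈A =
        let (δ , δ>0 , near⊆A) = A-open x∈A ; (N , within) = ball-within δ>0 ; (i , x∈) = ball-cover N x
        in (i , N) , x∈ , λ y∈ → near⊆A (within ℕ.≤-refl x∈ y∈)

      -- Separatedness of the metric yields a `δ` for which d(x,y) < δ fails, and balls of diameter
      -- below `δ` cannot contain both points.
      balls-separate : ∀ {x y} → x ≢ y → ∃[ N ] (∀ m → N ≤ m → ∀ i → ¬ (Ball (i , m) x × Ball (i , m) y))
      balls-separate {x} {y} x≢y =
        let (δ , far) = ¬∀⇒∃¬ (λ (close : ∀ δ → 0ℚ ℚ.< δ → d< x y δ) → x≢y (separated (close _)))
            δ>0 = byContradiction λ ¬δ>0 → far (⊥-elim ∘ ¬δ>0)
            (N , within) = ball-within δ>0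
        in N , λ m N≤m i (x∈ , y∈) → far λ _ → within N≤m x∈ y∈

    κ : X → ℕ × ℕ → ℕ
    κ x j = indicator (Ball j x)

    abstract
      balls-determine : ∀ {x y} → (∀ j → Ball j x ⇔ Ball j y) → x ≡ y
      balls-determine {x} {y} same = byContradiction λ x≢y →
        let (N , apart) = balls-separate x≢y ; (i , x∈) = ball-cover N x
        in apart N ℕ.≤-refl i (x∈ , Equivalence.to (same (i , N)) x∈)

      κ-faithful : Faithful κ
      κ-faithful same = balls-determine λ j → mk⇔
        (λ x∈ → indicator≡1⁻¹ (trans (sym (same j)) (indicator≡1 x∈)))
        (λ y∈ → indicator≡1⁻¹ (trans (same j) (indicator≡1 y∈)))

    Meet : ℕ × ℕ → ℕ × ℕ → Set
    Meet j k = ∃[ x ] (Ball j x × Ball k x)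

    -- The closure of `Ball j`.
    Adherent : ℕ × ℕ → Pred X 0ℓ
    Adherent j x = ∀ δ → 0ℚ ℚ.< δ → ∃[ y ] (d< x y δ × Ball j y)

    -- These conditions characterise the sets {j : x ∈ Ball j} of indices.
    IsCode : Pred (ℕ × ℕ) 0ℓ → Set
    IsCode a = (∀ m → ∃[ i ] a (i , m))
             × (∀ j k → a j → a k → Meet j k)
             × (∀ j → a j → ∃[ k ] (a k × Adherent k ⊆ Ball j))
             × (∀ j k → Ball k ⊆ Ball j → a k → a j)

    abstract
      code-of-point : ∀ x → IsCode (λ j → Ball j x)
      code-of-point x = (λ m → ball-cover m x) , (λ j k x∈j x∈k → x , x∈j , x∈k) , shrink , λ j k sub → sub
        where
        shrink : ∀ j → Ball j x → ∃[ k ] (Ball k x × Adherent k ⊆ Ball j)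
        shrink j x∈j =
          let (δ , δ>0 , near⊆) = ball-open j x∈j ; (η , η>0 , η+η≡δ) = halve δ>0
              (N , within) = ball-within η>0 ; (i , x∈) = ball-cover N x
          in (i , N) , x∈ , λ {z} adherent → let (y , zy<η , y∈) = adherent η η>0 in
               near⊆ (subst (d< x z) η+η≡δ (triangle (within ℕ.≤-refl x∈ y∈) (d-sym zy<η)))

    abstract
      -- Points `s m` of chosen balls of level `m` form a Cauchy sequence, because any two of these
      -- balls meet. The limit `x` lies in `Ball j` for each `j` in `a`, as it is adherent to a
      -- refining ball `k`. Conversely, if `x` is in `Ball j`, some chosen ball is contained in
      -- `Ball j`, and enlargement puts `j` into `a`.
      point-of-code : ∀ a → IsCode a → ∃[ x ] (∀ j → a j ⇔ Ball j x)
      point-of-code a (small , meet , refine , enlarge) = x , λ j → mk⇔ (to j) (from j)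
        where
        centre : ℕ → ℕ
        centre m = proj₁ (small m)
        s : ℕ → X
        s m = proj₁ (meet _ _ (proj₂ (small m)) (proj₂ (small m)))
        s∈ : ∀ m → Ball (centre m , m) (s m)
        s∈ m = proj₁ (proj₂ (meet _ _ (proj₂ (small m)) (proj₂ (small m))))
        cauchy : Cauchy s
        cauchy δ>0 =
          let (η , η>0 , η+η≡δ) = halve δ>0 ; (N , within) = ball-within η>0
          in N , λ {m} {m′} N≤m N≤m′ →
            let (z , z∈ , z∈′) = meet _ _ (proj₂ (small m)) (proj₂ (small m′))
            in subst (d< (s m) (s m′)) η+η≡δ (triangle (within N≤m (s∈ m) z∈) (within N≤m′ z∈′ (s∈ m′)))
        x : X
        x = proj₁ (complete s cauchy)
        shrinking : ∀ {δ} → 0ℚ ℚ.< δ → ∃[ m ] (∀ {y} → Ball (centre m , m) y → d< x y δ)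
        shrinking δ>0 =
          let (η , η>0 , η+η≡δ) = halve δ>0 ; (N , within) = ball-within η>0
              (N′ , close) = proj₂ (complete s cauchy) η>0 ; m = N ⊔ N′
          in m , λ {y} y∈ → subst (d< x y) η+η≡δ
               (triangle (d-sym (close (ℕ.m≤n⊔m N N′))) (within (ℕ.m≤m⊔n N N′) (s∈ m) y∈))
        to : ∀ j → a j → Ball j x
        to j aj = let (k , ak , adherent⊆) = refine j aj in adherent⊆ λ δ δ>0 →
          let (m , near) = shrinking δ>0 ; (y , y∈ , y∈k) = meet _ _ (proj₂ (small m)) ak
          in y , near y∈ , y∈k
        from : ∀ j → Ball j x → a j
        from j x∈j = let (δ , δ>0 , near⊆) = ball-open j x∈j ; (m , near) = shrinking δ>0 in
          enlarge j (centre m , m) (λ y∈ → near⊆ (near y∈)) (proj₂ (small m))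

    abstract
      isCode-measurable : (𝓐 : σ-Algebra Y) {V : ℕ × ℕ → Pred Y 0ℓ} → (∀ j → Measurable 𝓐 (V j)) →
                          Measurable 𝓐 (λ y → IsCode (λ j → V j y))
      isCode-measurable 𝓐 MV =
        measurable-× 𝓐 (measurable-∀ 𝓐 countable-ℕ λ m → measurable-∃ 𝓐 countable-ℕ λ i → MV (i , m))
        (measurable-× 𝓐 (∀ⱼ λ j → ∀ⱼ λ k → measurable-→ 𝓐 (MV j) (measurable-→ 𝓐 (MV k) (measurable-const 𝓐 _)))
        (measurable-× 𝓐 (∀ⱼ λ j → measurable-→ 𝓐 (MV j)
                          (measurable-∃ 𝓐 countable-balls λ k → measurable-× 𝓐 (MV k) (measurable-const 𝓐 _)))
                        (∀ⱼ λ j → ∀ⱼ λ k → measurable-→ 𝓐 (measurable-const 𝓐 _) (measurable-→ 𝓐 (MV k) (MV j)))))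
        where
        ∀ⱼ : {A : ℕ × ℕ → Pred _ 0ℓ} → (∀ j → Measurable 𝓐 (A j)) → Measurable 𝓐 (λ y → ∀ j → A j y)
        ∀ⱼ = measurable-∀ 𝓐 countable-balls

  -- Borel sets as analytic sets with analytic complement

  module _ (𝕏 : StandardBorelSpace) where
    open StandardBorelSpace 𝕏 using (metric; generates) renaming (Carrier to X; borel to 𝓑)
    open PolishMetric metric using (Open)

    private
      Ball′ : ℕ × ℕ → Pred X 0ℓ
      Ball′ = Ball 𝕏
      κ′ : X → ℕ × ℕ → ℕ
      κ′ = κ 𝕏

    -- The set of codes need not be closed, because `IsCode` contains existential quantifiers.
    -- Storing their witnesses, a centre at `small m` and the number of a refining ball at
    -- `refine j`, turns the conditions into closed ones.
    analytic-U : Analytic (κ 𝕏) U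
    analytic-U = record
      { Index     = Index
      ; countable = countable-⊎ (countable-balls 𝕏) (countable-⊎ countable-ℕ (countable-balls 𝕏))
      ; place     = inj₁
      ; Body      = Body
      ; closed    = closed
      ; sound     = λ {f} → sound {f}
      ; complete  = λ {x} _ → complete x
      }
      where
      Index : Set
      Index = (ℕ × ℕ) ⊎ (ℕ ⊎ (ℕ × ℕ))
      small : ℕ → Index
      small m = inj₂ (inj₁ m)
      refine : ℕ × ℕ → Index
      refine j = inj₂ (inj₂ j)
      ball : ℕ → ℕ × ℕ
      ball = proj₁ (countable-balls 𝕏)
      Inside : (Index → ℕ) → Pred (ℕ × ℕ) 0ℓ
      Inside f j = f (inj₁ j) ≡ 1
      Body : Pred (Index → ℕ) 0ℓ
      Body f = (∀ j → f (inj₁ j) ≡ 0 ⊎ f (inj₁ j) ≡ 1)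
             × (∀ m → Inside f (f (small m) , m))
             × (∀ j k → Inside f j → Inside f k → Meet 𝕏 j k)
             × (∀ j → Inside f j → Inside f (ball (f (refine j))) × Adherent 𝕏 (ball (f (refine j))) ⊆ Ball′ j)
             × (∀ j k → Ball′ k ⊆ Ball′ j → Inside f k → Inside f j)
      closed : Closed Body
      closed =
        closed-× (closed-∀ λ j → closed-local λ f → inj₁ j ∷ [] , λ { g (eq ∷ []) → subst (λ v → v ≡ 0 ⊎ v ≡ 1) eq })
        (closed-× (closed-∀ λ m → closed-local λ f → small m ∷ inj₁ (f (small m) , m) ∷ [] ,
          λ { g (eq ∷ eq′ ∷ []) g1 → trans (sym eq′) (subst (λ i → g (inj₁ (i , m)) ≡ 1) eq g1) })
        (closed-× (closed-∀ λ j → closed-∀ λ k → closed-local λ f → inj₁ j ∷ inj₁ k ∷ [] ,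
          λ { g (eq ∷ eq′ ∷ []) R fj fk → R (trans eq fj) (trans eq′ fk) })
        (closed-× (closed-∀ λ j → closed-local λ f → inj₁ j ∷ refine j ∷ inj₁ (ball (f (refine j))) ∷ [] ,
          λ { g (eq ∷ eq′ ∷ eq″ ∷ []) R fj → let (gk , sub) = R (trans eq fj) in
              trans (sym eq″) (subst (λ n → g (inj₁ (ball n)) ≡ 1) eq′ gk) ,
              subst (λ n → Adherent 𝕏 (ball n) ⊆ Ball′ j) eq′ sub })
        (closed-∀ λ j → closed-∀ λ k → closed-local λ f → inj₁ j ∷ inj₁ k ∷ [] ,
          λ { g (eq ∷ eq′ ∷ []) R sub fk → trans (sym eq) (R sub (trans eq′ fk)) }))))
      sound : ∀ {f} → Body f → ∃[ x ] (x ∈ U × ∀ j → f (inj₁ j) ≡ κ′ x j)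
      sound {f} (bits , smalls , meet , refines , enlarge)
        with point-of-code 𝕏 (Inside f) ((λ m → f (small m) , smalls m) , meet , (λ j fj → _ , refines j fj) , enlarge)
      ... | x , inside⇔ = x , _ , code
        where
        code : ∀ j → f (inj₁ j) ≡ κ′ x j
        code j with bits j
        ... | inj₂ f≡1 = trans f≡1 (sym (indicator≡1 (Equivalence.to (inside⇔ j) f≡1)))
        ... | inj₁ f≡0 = trans f≡0 (sym (indicator≡0 λ x∈ →
                ℕ.0≢1+n (trans (sym f≡0) (Equivalence.from (inside⇔ j) x∈))))
      complete : ∀ x → ∃[ f ] (Body f × ∀ j → f (inj₁ j) ≡ κ′ x j)
      complete x with code-of-point 𝕏 x
      ... | smalls , meets , refines , enlarges = f , (bits , smalls′ , meets′ , refines′ , enlarges′) , λ _ → refl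
        where
        refinement : ∀ j → Dec (Ball′ j x) → ℕ
        refinement j (yes x∈) = proj₁ (proj₂ (countable-balls 𝕏) (proj₁ (refines j x∈)))
        -- A default: refinement is demanded only of balls that contain `x`.
        refinement j (no _)   = 0
        f : Index → ℕ
        f (inj₁ j)        = κ′ x j
        f (inj₂ (inj₁ m)) = proj₁ (smalls m)
        f (inj₂ (inj₂ j)) = refinement j em
        bits : ∀ j → κ′ x j ≡ 0 ⊎ κ′ x j ≡ 1
        bits j = indicator-bit (Ball′ j x)
        smalls′ : ∀ m → Inside f (f (small m) , m)
        smalls′ m = indicator≡1 (proj₂ (smalls m))
        meets′ : ∀ j k → Inside f j → Inside f k → Meet 𝕏 j k
        meets′ j k x∈j x∈k = meets j k (indicator≡1⁻¹ x∈j) (indicator≡1⁻¹ x∈k)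
        refines′ : ∀ j → Inside f j → Inside f (ball (f (refine j))) × Adherent 𝕏 (ball (f (refine j))) ⊆ Ball′ j
        refines′ j x∈j with em {P = Ball′ j x}
        ... | no x∉ = ⊥-elim (x∉ (indicator≡1⁻¹ x∈j))
        ... | yes x∈ with proj₂ (countable-balls 𝕏) (proj₁ (refines j x∈))
        ...   | n , eq = indicator≡1 (subst (λ k → Ball′ k x) (sym eq) (proj₁ (proj₂ (refines j x∈)))) ,
                         subst (λ k → Adherent 𝕏 k ⊆ Ball′ j) (sym eq) (proj₂ (proj₂ (refines j x∈)))
        enlarges′ : ∀ j k → Ball′ k ⊆ Ball′ j → Inside f k → Inside f j
        enlarges′ j k sub x∈k = indicator≡1 (sub (indicator≡1⁻¹ x∈k))

    -- Membership and its negation each fix one coordinate of the code, to 1 or to 0, which adds a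
    -- closed condition to the body of `analytic-U`.
    ball-biAnalytic : ∀ j → BiAnalytic (κ 𝕏) (Ball 𝕏 j)
    ball-biAnalytic j = coordinate 1 (indicator≡1⁻¹ , indicator≡1) ,
      coordinate 0 ((λ eq x∈ → ℕ.0≢1+n (trans (sym eq) (indicator≡1 x∈))) , indicator≡0)
      where
      open Analytic analytic-U
      coordinate : ∀ v {A} → (∀ {x} → κ′ x j ≡ v → x ∈ A) × (∀ {x} → x ∈ A → κ′ x j ≡ v) → Analytic (κ 𝕏) A
      coordinate v (to , from) = record
        { Index = Index ; countable = countable ; place = place
        ; Body = λ f → Body f × f (place j) ≡ v
        ; closed = closed-× closed (closed-local λ f → place j ∷ [] , λ { g (eq ∷ []) eq′ → trans (sym eq) eq′ })
        ; sound = λ {f} (Rf , fj≡v) → let (x , _ , code) = sound {f} Rf in x , to (trans (sym (code j)) fj≡v) , code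
        ; complete = λ {x} x∈A → let (f , Rf , code) = complete {x} _ in f , (Rf , trans (code j) (from x∈A)) , code
        }

    abstract
      -- An open set is the countable union of the balls that it contains, and its complement is the
      -- intersection of the complements of these balls.
      open-biAnalytic : ∀ {A} → Open A → BiAnalytic (κ 𝕏) A
      open-biAnalytic {A} A-open =
        analytic-≐ ((λ (j , sub , x∈) → sub x∈) ,
                    λ x∈A → let (j , x∈ , sub) = ball-base 𝕏 A-open x∈A in j , (λ {y} → sub {y}) , x∈)
          (analytic-∃ cB cB λ j → within j) ,
        analytic-≐ (outside , λ x∉A n sub x∈ → x∉A (sub x∈))
          (analytic-⋂ (κ-faithful 𝕏) λ n → without (proj₁ cB n))
        where
        cB : Countable (ℕ × ℕ)
        cB = countable-balls 𝕏
        outside : ∀ {x} → (∀ n → Ball′ (proj₁ cB n) ⊆ A → ¬ Ball′ (proj₁ cB n) x) → x ∉ A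
        outside {x} out x∈A = avoid (ball-base 𝕏 A-open x∈A)
          where
          avoid : ¬ (∃[ j ] (Ball′ j x × Ball′ j ⊆ A))
          avoid (j , x∈ , sub) = let (n , eq) = proj₂ cB j in
            out n (subst (λ k → Ball′ k ⊆ A) (sym eq) sub) (subst (λ k → Ball′ k x) (sym eq) x∈)
        within : ∀ j → Analytic (κ 𝕏) (λ x → Ball′ j ⊆ A × Ball′ j x)
        within j with em {P = Ball′ j ⊆ A}
        ... | yes sub  = analytic-≐ ((λ x∈ → (λ {y} → sub {y}) , x∈) , proj₂) (proj₁ (ball-biAnalytic j))
        ... | no ¬sub = analytic-≐ ((λ ()) , λ (sub , _) → ¬sub sub) (analytic-∅ cB)
        without : ∀ j → Analytic (κ 𝕏) (λ x → Ball′ j ⊆ A → ¬ Ball′ j x)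
        without j with em {P = Ball′ j ⊆ A}
        ... | yes sub  = analytic-≐ ((λ x∉ _ → x∉) , λ h → h sub) (proj₂ (ball-biAnalytic j))
        ... | no ¬sub = analytic-≐ ((λ _ sub → ⊥-elim (¬sub sub)) , _) analytic-U

      borel-biAnalytic : ∀ {A} → Measurable 𝓑 A → BiAnalytic (κ 𝕏) A
      borel-biAnalytic MA =
        generated-biAnalytic (κ-faithful 𝕏) (countable-balls 𝕏) analytic-U
          open-biAnalytic (Equivalence.to (generates _) MA)

    κ² : X × X → (ℕ × ℕ) ⊎ (ℕ × ℕ) → ℕ
    κ² = κ 𝕏 ⊗ κ 𝕏

    abstract
      -- The generators of the product structure are the cylinders B × X and X × B, which are
      -- analytic as products, and so are their complements.
      square-biAnalytic : ∀ {A} → Measurable (square 𝓑) A → BiAnalytic κ² A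
      square-biAnalytic = generated-biAnalytic (⊗-faithful (κ-faithful 𝕏) (κ-faithful 𝕏))
        (countable-⊎ (countable-balls 𝕏) (countable-balls 𝕏))
        (analytic-≐ (_ , _) (analytic-⟨×⟩ analytic-U analytic-U))
        λ { (true , B , MB , to , from) → rectangle to from
              (analytic-≐ (proj₁ , (_, _)) (analytic-⟨×⟩ (proj₁ (borel-biAnalytic MB)) analytic-U))
              (analytic-≐ (proj₁ , (_, _)) (analytic-⟨×⟩ (proj₂ (borel-biAnalytic MB)) analytic-U))
          ; (false , B , MB , to , from) → rectangle to from
              (analytic-≐ (proj₂ , (_ ,_)) (analytic-⟨×⟩ analytic-U (proj₁ (borel-biAnalytic MB))))
              (analytic-≐ (proj₂ , (_ ,_)) (analytic-⟨×⟩ analytic-U (proj₂ (borel-biAnalytic MB)))) }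
        where
        rectangle : ∀ {A B : Pred (X × X) 0ℓ} → A ⊆ B → B ⊆ A → Analytic κ² B → Analytic κ² (∁ B) → BiAnalytic κ² A
        rectangle to from pos neg = analytic-≐ (from , to) pos , analytic-≐ ((λ ¬b → ¬b ∘ to) , λ ¬a → ¬a ∘ from) neg

  -- Borel maps covering a hyperfinite equivalence relation

  uniform-bound : {P : Y → ℕ → Set} (L : List Y) → (∀ {y} → y ∈ˡ L → ∃[ N ] (∀ m → N ≤ m → P y m)) →
                  ∃[ N ] (∀ m → N ≤ m → ∀ {y} → y ∈ˡ L → P y m)
  uniform-bound []      h = 0 , λ _ _ ()
  uniform-bound {P = P} (y ∷ L) h = N ⊔ N′ , bounds
    where
    N N′ : ℕ
    N  = proj₁ (h (here refl))
    N′ = proj₁ (uniform-bound {P = P} L (h ∘ there))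
    bounds : ∀ m → N ⊔ N′ ≤ m → ∀ {z} → z ∈ˡ (y ∷ L) → P z m
    bounds m N≤m (here refl) = proj₂ (h (here refl)) m (ℕ.≤-trans (ℕ.m≤m⊔n N N′) N≤m)
    bounds m N≤m (there z∈L) = proj₂ (uniform-bound {P = P} L (h ∘ there)) m (ℕ.≤-trans (ℕ.m≤n⊔m N N′) N≤m) z∈L

  module _ (𝕏 : StandardBorelSpace) where
    open StandardBorelSpace 𝕏 using (metric; generates) renaming (Carrier to X; borel to 𝓑)
    open PolishMetric metric using (Open)

    private
      BorelMap : (X → X) → Set₁
      BorelMap = IsMeasurableMap 𝓑 𝓑

      Ball′ : ℕ × ℕ → Pred X 0ℓ
      Ball′ = Ball 𝕏

    -- The balls are a countable base, so the preimage of an open set is a countable union of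
    -- preimages of balls; the remaining Borel sets follow by induction on their generation.
    borelMap-on-balls : {g : X → X} → (∀ j → Measurable 𝓑 (g ⊢ Ball 𝕏 j)) → BorelMap g
    borelMap-on-balls {g} g-balls B MB = go (Equivalence.to (generates B) MB)
      where
      module 𝓑 = σ-Algebra 𝓑
      go : ∀ {A} → Generated Open A → Measurable 𝓑 (g ⊢ A)
      go {A} (basic A-open) = 𝓑.resp-≐
        ((λ (j , sub , x∈) → sub x∈) ,
         λ x∈A → let (j , x∈ , sub) = ball-base 𝕏 A-open x∈A in j , (λ {y} → sub {y}) , x∈)
        (measurable-∃ 𝓑 (countable-balls 𝕏) λ j →
          measurable-× 𝓑 (measurable-const 𝓑 (Ball 𝕏 j ⊆ A)) (g-balls j))
      go (resp-≐ (to , from) MA) = 𝓑.resp-≐ (to , from) (go MA)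
      go whole                   = 𝓑.whole
      go (complement MA)         = 𝓑.complement (go MA)
      go (union MA)              = 𝓑.union λ i → go (MA i)

    -- Novikov's theorem for the sequence A, B, B, ...: a point of `B` lies in every `V (suc n)`,
    -- hence outside `V 0`.
    separation : {A B : Pred X 0ℓ} → Analytic (κ 𝕏) A → Analytic (κ 𝕏) B → (∀ {x} → x ∈ A → x ∉ B) →
                 Σ[ V ∈ Pred X 0ℓ ] (Measurable 𝓑 V × A ⊆ V × (∀ {x} → x ∈ B → x ∉ V))
    separation {A} {B} 𝒜 ℬ disjoint = V 0 , V-measurable 0 , contains 0 , avoids
      where
      family : ℕ → Pred X 0ℓ
      family zero    = A
      family (suc _) = B
      separated : Separated 𝓑 family
      separated = novikov-separation 𝓑 (κ-faithful 𝕏) (λ j → indicator-measurable 𝓑 (ball-measurable 𝕏 j))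
        {family} (λ { zero → 𝒜 ; (suc _) → ℬ })
        (λ x → ¬∀⇒∃¬ λ x∈ → disjoint (x∈ 0) (x∈ 1))
      V : ℕ → Pred X 0ℓ
      V = proj₁ separated
      V-measurable : ∀ n → Measurable 𝓑 (V n)
      V-measurable = proj₁ (proj₂ separated)
      contains : ∀ n → family n ⊆ V n
      contains = proj₁ (proj₂ (proj₂ separated))
      avoids : ∀ {x} → x ∈ B → x ∉ V 0
      avoids {x} x∈B x∈V with proj₂ (proj₂ (proj₂ separated)) x
      ... | zero  , x∉ = x∉ x∈V
      ... | suc n , x∉ = x∉ (contains (suc n) x∈B)

    -- If D x ⊆ {y}, the sets {x : y ∈ Ball j} and {x : y ∉ Ball j} can be
    -- separated by Borel sets V j, and the code of y is read off from V.
    abstract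
      functional⇒borelMap : {D : Pred (X × X) 0ℓ} → Analytic (κ² 𝕏) D →
        (∀ {x y z} → D (x , y) → D (x , z) → y ≡ z) →
        Σ[ g ∈ (X → X) ] (BorelMap g × (∀ {x y} → D (x , y) → g x ≡ y))
      functional⇒borelMap {D} 𝒟 functional = g , g-borel , g-extends
        where
        cut : ∀ {A} → Analytic (κ 𝕏) A → Analytic (κ 𝕏) (λ x → ∃[ y ] (D (x , y) × A y))
        cut {A} 𝒜 = analytic-proj (analytic-≐ ((λ (d , _ , a) → d , a) , λ (d , a) → d , _ , a)
          (analytic-∩ (⊗-faithful (κ-faithful 𝕏) (κ-faithful 𝕏)) {D} {U ⟨×⟩ A}
            𝒟 (analytic-⟨×⟩ (analytic-U 𝕏) 𝒜)))
        Cut : Pred X 0ℓ → Pred X 0ℓ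
        Cut A x = ∃[ y ] (D (x , y) × A y)
        separated : ∀ j → Σ[ V ∈ Pred X 0ℓ ]
          (Measurable 𝓑 V × Cut (Ball′ j) ⊆ V × (∀ {x} → x ∈ Cut (∁ (Ball′ j)) → x ∉ V))
        separated j = separation (cut (proj₁ (ball-biAnalytic 𝕏 j))) (cut (proj₂ (ball-biAnalytic 𝕏 j)))
          λ { (y , d , y∈) (z , d′ , z∉) → z∉ (subst (Ball′ j) (functional d d′) y∈) }
        V : ℕ × ℕ → Pred X 0ℓ
        V j = proj₁ (separated j)
        V-measurable : ∀ j → Measurable 𝓑 (V j)
        V-measurable j = proj₁ (proj₂ (separated j))
        V-to : ∀ {x y} → D (x , y) → ∀ {j} → V j x → Ball′ j y
        V-to d {j} x∈V = byContradiction λ y∉ → proj₂ (proj₂ (proj₂ (separated j))) (_ , d , y∉) x∈V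
        V-from : ∀ {x y} → D (x , y) → ∀ {j} → Ball′ j y → V j x
        V-from d {j} y∈ = proj₁ (proj₂ (proj₂ (separated j))) (_ , d , y∈)
        -- Where the section of `D` is empty, the sets `V j` need not give a code. Off `Domain` the
        -- value is `x` itself, and the case split is Borel because `Domain` is.
        Domain : Pred X 0ℓ
        Domain x = IsCode 𝕏 (λ j → V j x)
        decode : ∀ x → Dec (Domain x) → X
        decode x (yes code) = proj₁ (point-of-code 𝕏 (λ j → V j x) code)
        decode x (no _)     = x
        decode⇔ : ∀ x (d : Dec (Domain x)) → Domain x → ∀ j → V j x ⇔ Ball′ j (decode x d)
        decode⇔ x (yes code) _ = proj₂ (point-of-code 𝕏 (λ j → V j x) code)
        decode⇔ x (no ¬code) code = ⊥-elim (¬code code)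
        decode-default : ∀ x (d : Dec (Domain x)) → ¬ Domain x → decode x d ≡ x
        decode-default x (yes code) ¬code = ⊥-elim (¬code code)
        decode-default x (no _)     _     = refl
        g : X → X
        g x = decode x em
        g-borel : BorelMap g
        g-borel = borelMap-on-balls λ j → σ-Algebra.resp-≐ 𝓑
          ( (λ { {x} (inj₁ (code , x∈V)) → Equivalence.to (decode⇔ x em code j) x∈V
               ; {x} (inj₂ (¬code , x∈)) → subst (Ball′ j) (sym (decode-default x em ¬code)) x∈ })
          , λ {x} gx∈ → cases j x gx∈ (em {P = Domain x}) )
          (measurable-⊎ 𝓑 (measurable-× 𝓑 Domain-measurable (V-measurable j))
                          (measurable-× 𝓑 (σ-Algebra.complement 𝓑 Domain-measurable) (ball-measurable 𝕏 j)))
          where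
          Domain-measurable : Measurable 𝓑 Domain
          Domain-measurable = isCode-measurable 𝕏 𝓑 V-measurable
          cases : ∀ j x → Ball′ j (g x) → Dec (Domain x) → (Domain x × V j x) ⊎ (¬ Domain x × Ball′ j x)
          cases j x gx∈ (yes code) = inj₁ (code , Equivalence.from (decode⇔ x em code j) gx∈)
          cases j x gx∈ (no ¬code) = inj₂ (¬code , subst (Ball′ j) (decode-default x em ¬code) gx∈)
        isCode : ∀ x {y} → D (x , y) → Domain x
        isCode x {y} d = let (small , meet , refine , enlarge) = code-of-point 𝕏 y in
          (λ m → let (i , y∈) = small m in i , V-from d {i , m} y∈) ,
          (λ j k x∈j x∈k → meet j k (V-to d {j} x∈j) (V-to d {k} x∈k)) ,
          (λ j x∈ → let (k , y∈ , sub) = refine j (V-to d {j} x∈) in k , V-from d {k} y∈ , (λ {z} → sub {z})) ,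
          λ j k sub x∈ → V-from d {j} (enlarge j k (λ {z} → sub {z}) (V-to d {k} x∈))
        g-extends : ∀ {x y} → D (x , y) → g x ≡ y
        g-extends {x} {y} d = balls-determine 𝕏 λ j → mk⇔
          (λ gx∈ → V-to d {j} (Equivalence.from (decode⇔ x em (isCode x d) j) gx∈))
          (λ y∈ → Equivalence.to (decode⇔ x em (isCode x d) j) (V-from d {j} y∈))

    -- W n collects the points whose section contains two points of a common ball
    -- of level n; off W n, the points of a section are told apart by these balls.
    abstract
      finite-sections⇒borelMaps : (F : Rel X 0ℓ) → BorelRel 𝕏 F → (∀ x → Finite (F x)) →
        Σ[ g ∈ (ℕ × ℕ → X → X) ] ((∀ j → BorelMap (g j)) × (∀ {x y} → F x y → ∃[ j ] g j x ≡ y))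
      finite-sections⇒borelMaps F F-borel F-finite =
        (λ j → proj₁ (map j)) , (λ j → proj₁ (proj₂ (map j))) , covers
        where
        cB : Countable (ℕ × ℕ)
        cB = countable-balls 𝕏
        ℱ : Analytic (κ² 𝕏) (uncurry F)
        ℱ = proj₁ (square-biAnalytic 𝕏 F-borel)
        faithful² : Faithful (κ² 𝕏)
        faithful² = ⊗-faithful (κ-faithful 𝕏) (κ-faithful 𝕏)
        Hits : Pred X 0ℓ → Pred X 0ℓ
        Hits A x = ∃[ y ] (F x y × A y)
        hits-analytic : ∀ {A} → Analytic (κ 𝕏) A → Analytic (κ 𝕏) (Hits A)
        hits-analytic {A} 𝒜 = analytic-proj {A = λ (x , y) → F x y × A y}
          (analytic-≐ ((λ (xFy , _ , a) → xFy , a) , λ (xFy , a) → xFy , _ , a)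
          (analytic-∩ faithful² {uncurry F} {U ⟨×⟩ A} ℱ (analytic-⟨×⟩ (analytic-U 𝕏) 𝒜)))
        -- Distinct points are told apart by some ball `j`, so the quantifier over distinct pairs
        -- becomes a countable union of intersections of two analytic sets.
        W′ : ℕ → ℕ → ℕ × ℕ → Pred X 0ℓ
        W′ n i j = Hits (Ball′ (i , n) ∩ Ball′ j) ∩ Hits (Ball′ (i , n) ∩ ∁ (Ball′ j))
        W : ℕ → Pred X 0ℓ
        W n x = ∃[ i ] ∃[ j ] W′ n i j x
        W-analytic : ∀ n → Analytic (κ 𝕏) (W n)
        W-analytic n = analytic-∃ cB countable-ℕ λ i → analytic-∃ cB cB λ j →
          analytic-∩ (κ-faithful 𝕏)
            (hits-analytic (analytic-∩ (κ-faithful 𝕏) (proj₁ (ball-biAnalytic 𝕏 (i , n))) (proj₁ (ball-biAnalytic 𝕏 j))))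
            (hits-analytic (analytic-∩ (κ-faithful 𝕏) (proj₁ (ball-biAnalytic 𝕏 (i , n))) (proj₂ (ball-biAnalytic 𝕏 j))))
        W-intro : ∀ {n x y z} → F x y → F x z → y ≢ z → ∀ i → Ball′ (i , n) y → Ball′ (i , n) z → W n x
        W-intro {n} {x} {y} {z} xFy xFz y≢z i y∈ z∈ =
          let (N , apart) = balls-separate 𝕏 y≢z ; (k , y∈k) = ball-cover 𝕏 N y
          in i , (k , N) , (y , xFy , y∈ , y∈k) , (z , xFz , z∈ , λ z∈k → apart N ℕ.≤-refl k (y∈k , z∈k))
        W-empty : ∀ x → ∃[ n ] x ∉ W n
        -- From level `N` on, no ball contains two distinct entries of the finite list that covers
        -- the section at `x`.
        W-empty x = N , λ { (i , j , (y , xFy , y∈ , y∈j) , (z , xFz , z∈ , z∉j)) →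
            proj₂ bound N ℕ.≤-refl (proj₂ (F-finite x) xFy) (proj₂ (F-finite x) xFz)
              (λ { refl → z∉j y∈j }) i (y∈ , z∈) }
          where
          Apart : X → X → ℕ → Set
          Apart y z n = y ≢ z → ∀ i → ¬ (Ball′ (i , n) y × Ball′ (i , n) z)
          apart : ∀ y z → ∃[ N ] (∀ m → N ≤ m → Apart y z m)
          apart y z with em {P = y ≡ z}
          ... | yes y≡z = 0 , λ _ _ y≢z → ⊥-elim (y≢z y≡z)
          ... | no y≢z  = let (N , sep) = balls-separate 𝕏 y≢z in N , λ m N≤m _ → sep m N≤m
          L : List X
          L = proj₁ (F-finite x)
          bound : ∃[ N ] (∀ m → N ≤ m → ∀ {y} → y ∈ˡ L → ∀ {z} → z ∈ˡ L → Apart y z m)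
          bound = uniform-bound {P = λ y m → ∀ {z} → z ∈ˡ L → Apart y z m} L
            λ {y} _ → uniform-bound {P = Apart y} L λ {z} _ → apart y z
          N : ℕ
          N = proj₁ bound
        separated : Separated 𝓑 W
        separated = novikov-separation 𝓑 (κ-faithful 𝕏) (λ j → indicator-measurable 𝓑 (ball-measurable 𝕏 j))
          {W} W-analytic W-empty
        V : ℕ → Pred X 0ℓ
        V = proj₁ separated
        -- By `W-intro`, a ball of level `n` contains at most one point of the section at `x` when
        -- `x` is outside `V n`.
        D : ℕ × ℕ → Pred (X × X) 0ℓ
        D (i , n) (x , y) = F x y × (x ∉ V n × Ball′ (i , n) y)
        D-analytic : ∀ j → Analytic (κ² 𝕏) (D j)
        D-analytic (i , n) = analytic-∩ faithful² {uncurry F} {∁ (V n) ⟨×⟩ Ball′ (i , n)} ℱ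
          (analytic-⟨×⟩ (proj₂ (borel-biAnalytic 𝕏 (proj₁ (proj₂ separated) n))) (proj₁ (ball-biAnalytic 𝕏 (i , n))))
        D-functional : ∀ j {x y z} → D j (x , y) → D j (x , z) → y ≡ z
        D-functional (i , n) (xFy , x∉V , y∈) (xFz , _ , z∈) = byContradiction λ y≢z →
          x∉V (proj₁ (proj₂ (proj₂ separated)) n (W-intro xFy xFz y≢z i y∈ z∈))
        map : ∀ j → Σ[ g ∈ (X → X) ] (BorelMap g × (∀ {x y} → D j (x , y) → g x ≡ y))
        map j = functional⇒borelMap {D j} (D-analytic j) (λ {x} {y} {z} → D-functional j {x} {y} {z})
        covers : ∀ {x y} → F x y → ∃[ j ] proj₁ (map j) x ≡ y
        covers {x} {y} xFy =
          let (n , x∉V) = proj₂ (proj₂ (proj₂ separated)) x ; (i , y∈) = ball-cover 𝕏 n y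
          in (i , n) , proj₂ (proj₂ (map (i , n))) {x} {y} (xFy , x∉V , y∈)

    hyperfinite⇒borelMaps : {E : Rel X 0ℓ} → IsHyperfinite 𝕏 E →
      Σ[ g ∈ (ℕ → X → X) ] ((∀ j → BorelMap (g j)) × (∀ {x y} → E x y → ∃[ j ] g j x ≡ y))
    hyperfinite⇒borelMaps {E} hyp = (λ n → h (e n)) , (λ n → h-borel (e n)) , covers
      where
      open IsHyperfinite hyp
      maps : ∀ i → Σ[ g ∈ (ℕ × ℕ → X → X) ] ((∀ j → BorelMap (g j)) × (∀ {x y} → F i x y → ∃[ j ] g j x ≡ y))
      maps i = finite-sections⇒borelMaps (F i)
        (IsFiniteBorelEquivalence.isBorel (F-finite i)) (IsFiniteBorelEquivalence.isFinite (F-finite i))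
      pairs : Countable (ℕ × (ℕ × ℕ))
      pairs = countable-× countable-ℕ (countable-balls 𝕏)
      e : ℕ → ℕ × (ℕ × ℕ)
      e = proj₁ pairs
      h : ℕ × (ℕ × ℕ) → X → X
      h (i , j) = proj₁ (maps i) j
      h-borel : ∀ p → BorelMap (h p)
      h-borel (i , j) = proj₁ (proj₂ (maps i)) j
      covers : ∀ {x y} → E x y → ∃[ n ] h (e n) x ≡ y
      covers {x} {y} xEy =
        let (i , xFy) = Equivalence.to E-union xEy
            (j , gx≡y) = proj₂ (proj₂ (maps i)) {x} {y} xFy
            (n , en≡) = proj₂ pairs (i , j)
        in n , trans (cong (λ p → h p x) en≡) gx≡y

  -- Finite vectors and linear orders

  least : (f : Y → ℕ) {P : Pred Y 0ℓ} → ∃ P → ∃[ y ] (P y × (∀ z → f z ℕ.< f y → ¬ P z))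
  least f {P} (y , Py) = descend y Py (<-wellFounded (f y))
    where
    descend : ∀ y → P y → Acc ℕ._<_ (f y) → ∃[ y ] (P y × (∀ z → f z ℕ.< f y → ¬ P z))
    descend y Py (acc rs) with em {P = ∃[ z ] (f z ℕ.< f y × P z)}
    ... | yes (z , fz<fy , Pz) = descend z Pz (rs fz<fy)
    ... | no none              = y , Py , λ z fz<fy Pz → none (z , fz<fy , Pz)

  all≢⇒∉ : {x : T} {v : Vec T n} → All (x ≢_) v → x ∉ᵛ v
  all≢⇒∉ x≢ x∈v = All.lookup x≢ x∈v refl

  ∉⇒all≢ : {x : T} (v : Vec T n) → x ∉ᵛ v → All (x ≢_) v
  ∉⇒all≢ []      x∉ = []
  ∉⇒all≢ (y ∷ v) x∉ = (λ x≡y → x∉ (here x≡y)) ∷ ∉⇒all≢ v (x∉ ∘ there)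

  all-from-∈ : {P : Pred T 0ℓ} (v : Vec T n) → (∀ {z} → z ∈ᵛ v → P z) → All P v
  all-from-∈ []      h = []
  all-from-∈ (x ∷ v) h = h (here refl) ∷ all-from-∈ v (h ∘ there)

  remove : (v : Vec T (suc n)) → Unique v → ∀ {w} → w ∈ᵛ v →
    Σ[ v′ ∈ Vec T n ] (Unique v′ × w ∉ᵛ v′ × (_∈ᵛ v) ≐ (｛ w ｝ ∪ (_∈ᵛ v′)))
  remove (x ∷ v) (x≢ ∷ uniq) (here refl) = v , uniq , all≢⇒∉ x≢ ,
    (λ { (here z≡x) → inj₁ (sym z≡x) ; (there z∈v) → inj₂ z∈v }) ,
    λ { (inj₁ refl) → here refl ; (inj₂ z∈v) → there z∈v }
  remove {n = suc n} (x ∷ v) (x≢ ∷ uniq) {w} (there w∈v) =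
    let (v′ , uniq′ , w∉v′ , (to , from)) = remove v uniq w∈v in
    x ∷ v′ , ∉⇒all≢ v′ (λ x∈v′ → all≢⇒∉ x≢ (from (inj₂ x∈v′))) ∷ uniq′ ,
    (λ { (here w≡x) → all≢⇒∉ x≢ (subst (_∈ᵛ v) w≡x w∈v) ; (there w∈v′) → w∉v′ w∈v′ }) ,
    (λ { (here z≡x) → inj₂ (here z≡x)
       ; (there z∈v) → [ inj₁ , inj₂ ∘ there ] (to z∈v) }) ,
    λ { (inj₁ refl) → there w∈v
      ; (inj₂ (here z≡x)) → here z≡x
      ; (inj₂ (there z∈v′)) → there (from (inj₂ z∈v′)) }

  -- Passes from lists, which may repeat entries and leave `P`, to the repetition-free vectors
  -- demanded by `HasSize`. Keeping the entries of `v` provides the lower bound on the size.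
  adjoin : (P : Pred T 0ℓ) (v : Vec T n) → Unique v → All P v → (L : List T) →
    ∃[ N ] Σ[ v′ ∈ Vec T N ] (n ≤ N × Unique v′ × All P v′ × (_∈ᵛ v) ⊆ (_∈ᵛ v′) × (∀ {z} → z ∈ˡ L → P z → z ∈ᵛ v′))
  adjoin {n = n} P v uniq Pv [] = n , v , ℕ.≤-refl , uniq , Pv , id , λ ()
  adjoin P v uniq Pv (x ∷ L) with adjoin P v uniq Pv L
  ... | N , v′ , n≤N , uniq′ , Pv′ , v⊆v′ , L⊆v′ with em {P = P x × x ∉ᵛ v′}
  ...   | yes (Px , x∉v′) =
          suc N , x ∷ v′ , ℕ.m≤n⇒m≤1+n n≤N , ∉⇒all≢ v′ x∉v′ ∷ uniq′ , Px ∷ Pv′ , there ∘ v⊆v′ ,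
          λ { (here refl) _ → here refl ; (there z∈L) Pz → there (L⊆v′ z∈L Pz) }
  ...   | no ¬new =
          N , v′ , n≤N , uniq′ , Pv′ , v⊆v′ ,
          λ { (here refl) Pz → byContradiction (λ z∉ → ¬new (Pz , z∉)) ; (there z∈L) Pz → L⊆v′ z∈L Pz }

  infinite-avoids : {P : Pred T 0ℓ} → ¬ Finite P → ∀ L → ∃[ z ] (P z × ¬ (z ∈ˡ L))
  infinite-avoids infinite L = byContradiction λ none →
    infinite (L , λ {z} Pz → byContradiction λ z∉L → none (z , Pz , z∉L))

  ∈-toList : {z : T} {v : Vec T n} → z ∈ᵛ v → z ∈ˡ Vec.toList v
  ∈-toList (here z≡)  = here z≡
  ∈-toList (there z∈) = there (∈-toList z∈)

  infinite-vector : {P : Pred T 0ℓ} → ¬ Finite P → ∀ n → Σ[ v ∈ Vec T n ] (Unique v × All P v)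
  infinite-vector infinite zero = [] , [] , []
  infinite-vector infinite (suc n) =
    let (v , uniq , Pv) = infinite-vector infinite n
        (z , Pz , z∉) = infinite-avoids infinite (Vec.toList v)
    in z ∷ v , ∉⇒all≢ v (z∉ ∘ ∈-toList) ∷ uniq , Pz ∷ Pv

  vectors : List T → ∀ n → List (Vec T n)
  vectors L zero    = [] ∷ []
  vectors L (suc n) = List.concatMap (λ x → List.map (x ∷_) (vectors L n)) L

  ∈-concatMap-intro : (f : Y → List T) {L : List Y} {y : Y} {x : T} → y ∈ˡ L → x ∈ˡ f y → x ∈ˡ List.concatMap f L
  ∈-concatMap-intro f (here refl)  x∈ = ∈-++⁺ˡ x∈
  ∈-concatMap-intro f {y ∷ _} (there y∈) x∈ = ∈-++⁺ʳ (f y) (∈-concatMap-intro f y∈ x∈)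

  ∈-vectors : {L : List T} (v : Vec T n) → All (_∈ˡ L) v → v ∈ˡ vectors L n
  ∈-vectors []      []          = here refl
  ∈-vectors (x ∷ v) (x∈L ∷ v∈L) = ∈-concatMap-intro _ x∈L (∈-map⁺ (x ∷_) (∈-vectors v v∈L))

  module _ {_<_ : Rel T 0ℓ} (order : IsStrictTotalOrder _≡_ _<_) where
    open IsStrictTotalOrder order using (compare) renaming (trans to <-trans; irrefl to <-irrefl)

    insert : ∀ x (v : Vec T n) → x ∉ᵛ v → AllPairs _<_ v →
             Σ[ v′ ∈ Vec T (suc n) ] (AllPairs _<_ v′ × (_∈ᵛ (x ∷ v)) ≐ (_∈ᵛ v′))
    insert x [] x∉ inc = x ∷ [] , [] ∷ [] , id , id
    insert x (y ∷ v) x∉ (y< ∷ inc) with compare x y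
    ... | tri< x<y _ _ = x ∷ y ∷ v , (x<y ∷ All.map (<-trans x<y) y<) ∷ y< ∷ inc , id , id
    ... | tri≈ _ x≡y _ = ⊥-elim (x∉ (here x≡y))
    ... | tri> _ _ y<x =
      let (v′ , inc′ , (to , from)) = insert x v (x∉ ∘ there) inc in
      y ∷ v′ , all-from-∈ v′ (λ z∈ → case-∈ (from z∈)) ∷ inc′ ,
      (λ { (here z≡x) → there (to (here z≡x)) ; (there (here z≡y)) → here z≡y ; (there (there z∈)) → there (to (there z∈)) }) ,
      λ { (here z≡y) → there (here z≡y) ; (there z∈) → swap (from z∈) }
      where
      case-∈ : ∀ {z} → z ∈ᵛ (x ∷ v) → y < z
      case-∈ (here refl) = y<x
      case-∈ (there z∈)  = All.lookup y< z∈
      swap : ∀ {z} → z ∈ᵛ (x ∷ v) → z ∈ᵛ (x ∷ y ∷ v)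
      swap (here z≡x) = here z≡x
      swap (there z∈) = there (there z∈)

    sort : (v : Vec T n) → Unique v → Σ[ v′ ∈ Vec T n ] (AllPairs _<_ v′ × (_∈ᵛ v) ≐ (_∈ᵛ v′))
    sort []      _ = [] , [] , id , id
    sort (x ∷ v) (x≢ ∷ uniq) =
      let (v′ , inc , (to , from)) = sort v uniq
          (v″ , inc″ , (to′ , from′)) = insert x v′ (all≢⇒∉ x≢ ∘ from) inc
      in v″ , inc″ ,
         (λ { (here z≡x) → to′ (here z≡x) ; (there z∈) → to′ (there (to z∈)) }) ,
         (λ z∈ → unsort from (from′ z∈))
      where
      unsort : ∀ {v′ : Vec T _} → (∀ {z} → z ∈ᵛ v′ → z ∈ᵛ v) → ∀ {z} → z ∈ᵛ (x ∷ v′) → z ∈ᵛ (x ∷ v)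
      unsort from (here z≡x) = here z≡x
      unsort from (there z∈) = there (from z∈)

    increasing⇒unique : {v : Vec T n} → AllPairs _<_ v → Unique v
    increasing⇒unique = AllPairs.map λ x<y x≡y → <-irrefl x≡y x<y

    minimum : {P : Pred T 0ℓ} → Finite P → ∃ P → ∃[ z ] (P z × (∀ y → P y → ¬ (y < z)))
    minimum {P} (L , P⊆L) (x , Px) =
      let (z , Pz , z-min) = go L x Px in z , Pz , λ y Py y<z → z-min y Py (P⊆L Py) y<z
      where
      go : ∀ L x → P x → ∃[ z ] (P z × (∀ y → P y → y ∈ˡ L → ¬ (y < z)))
      go [] x Px = x , Px , λ _ _ ()
      go (y ∷ L) x Px with go L x Px
      ... | z , Pz , z-min with em {P = P y × (y < z)}
      ...   | yes (Py , y<z) = y , Py , λ { w Pw (here refl) w<y → <-irrefl refl w<y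
                                          ; w Pw (there w∈) w<y → z-min w Pw w∈ (<-trans w<y y<z) }
      ...   | no ¬smaller = z , Pz , λ { w Pw (here refl) w<z → ¬smaller (Pw , w<z)
                                       ; w Pw (there w∈) w<z → z-min w Pw w∈ w<z }

  -- Monochromatic sequences

  inClass-≐ : {E : Rel Y 0ℓ} {n : ℕ} {A B : Pred Y 0ℓ} → A ≐ B → InClass E n A → InClass E n B
  inClass-≐ (A⊆B , B⊆A) ((v , uniq , A⊆v , v⊆A) , x , A⊆Ex) =
    (v , uniq , A⊆v ∘ B⊆A , A⊆B ∘ v⊆A) , x , A⊆Ex ∘ B⊆A

  module _
    (𝕏 : StandardBorelSpace) {_<_ : Rel (Carrier 𝕏) 0ℓ} (ord : IsBorelLinearOrder 𝕏 _<_)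
    {E : Rel (Carrier 𝕏) 0ℓ} (hyp : IsHyperfinite 𝕏 E) (aperiodic : Aperiodic E)
    {p k : ℕ} (c : Coloring E (suc p) k) (c-borel : IsBorelColoring 𝕏 ord c)
    (transitive : AlmostTransitive (IsHyperfinite.isEquivalence hyp) c) where

    open StandardBorelSpace 𝕏 using () renaming (Carrier to X; borel to 𝓑)
    open IsHyperfinite hyp
    open IsBorelLinearOrder ord using (isStrictTotalOrder) renaming (isBorel to <-borel)
    module E = IsEquivalence isEquivalence
    module F i = IsEquivalence (IsFiniteBorelEquivalence.isEquivalence (F-finite i))

    class-finite : ∀ i x → Finite (F i x)
    class-finite i = IsFiniteBorelEquivalence.isFinite (F-finite i)

    F⇒E : ∀ {i x y} → F i x y → E x y
    F⇒E {i} xFy = Equivalence.from E-union (i , xFy)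

    F-mono : ∀ {i j} → i ≤ j → ∀ {x y} → F i x y → F j x y
    F-mono i≤j = go (ℕ.≤⇒≤′ i≤j)
      where
      go : ∀ {i j} → i ℕ.≤′ j → ∀ {x y} → F i x y → F j x y
      go ℕ.≤′-refl       xFy = xFy
      go (ℕ.≤′-step i≤j) xFy = F-increasing _ (go i≤j xFy)

    abstract
      -- The colouring is defined only on increasing tuples inside a class. Extending each colour
      -- class to a Borel set of all tuples allows it to be pulled back along arbitrary Borel tuple
      -- maps.
      colour-trace : ∀ r → Σ[ B ∈ Pred (Vec X (suc p)) 0ℓ ] (Measurable (power 𝓑 (suc p)) B ×
        (λ (t : ∃ (IncreasingTuple _<_ E (suc p))) → color c (_∈ᵛ proj₁ t) (tupleInClass 𝕏 ord {k = k} t) ≡ r) ≐ (proj₁ ⊢ B))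
      colour-trace r = subspace-trace (power 𝓑 (suc p)) (IncreasingTuple _<_ E (suc p)) (c-borel (_≡ r) _)

    -- Meaningful only for increasing tuples contained in a class.
    HasColour : Fin k → Pred (Vec X (suc p)) 0ℓ
    HasColour r = proj₁ (colour-trace r)

    hasColour-intro : ∀ {r v} → AllPairs _<_ v → (a : InClass E (suc p) (_∈ᵛ v)) → color c (_∈ᵛ v) a ≡ r → HasColour r v
    hasColour-intro {r} {v} inc a@(_ , x , v⊆Ex) eq = proj₁ (proj₂ (proj₂ (colour-trace r)))
      {v , inc , x , all-from-∈ v v⊆Ex} (trans (color-cong c _ a (id , id)) eq)
      where open Coloring using (color-cong)

    hasColour-elim : ∀ {r v} → AllPairs _<_ v → (a : InClass E (suc p) (_∈ᵛ v)) → HasColour r v → color c (_∈ᵛ v) a ≡ r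
    hasColour-elim {r} {v} inc a@(_ , x , v⊆Ex) col = trans (color-cong c a _ (id , id))
      (proj₂ (proj₂ (proj₂ (colour-trace r))) {v , inc , x , all-from-∈ v v⊆Ex} col)
      where open Coloring using (color-cong)

    -- The `F m`-class of `y` stands in for an arbitrary finite subset of the E-class of `y`. Every
    -- such subset lies in that `F m`-class for large `m`, and the condition can now be expressed by
    -- countable quantifiers.
    record Good (r : Fin k) (m : ℕ) (y w : X) : Set where
      constructor good
      field
        outside : ¬ F m y w
        inClass : E y w
        colour  : ∀ v → AllPairs _<_ v → All (λ z → F m y z ⊎ z ≡ w) v → w ∈ᵛ v → HasColour r v

    Recurrent : Fin k → X → Set
    Recurrent r y = ∀ m → ∃[ w ] Good r m y w

    abstract
      -- Suppose that each colour `r` fails at a level given by `bad r`, and let a finite `A`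
      -- contain the classes of `y` at all these levels. By almost transitivity, a point `w` outside
      -- finitely many exceptions gives `{w} ∪ B` the same colour for all `B` with `p` elements in
      -- `A`. For this colour `r₀`, `w` is good at the level where `r₀` was to fail.
      recurrent-exists : ∀ y → ∃[ r ] Recurrent r y
      recurrent-exists y = byContradiction λ none →
        impossible λ r → ¬∀⇒∃¬ λ recurrent → none (r , recurrent)
        where
        open Coloring using (color-cong)
        impossible : (∀ r → ∃[ m ] ¬ (∃[ w ] Good r m y w)) → ⊥
        impossible bad = proj₂ (bad r₀) (w , good
          (λ yFw → w∉A (A-contains r₀ yFw)) yEw colour)
          where
          -- These `suc p` points make `A` large enough for almost transitivity, and all but the
          -- first of them form the reference set `B₀`.
          core : Σ[ v ∈ Vec X (suc p) ] (Unique v × All (E y) v)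
          core = infinite-vector (aperiodic y) (suc p)
          classes : Fin k → List X
          classes r = proj₁ (class-finite (proj₁ (bad r)) y)
          hull : ∃[ N ] Σ[ v ∈ Vec X N ] (suc p ≤ N × Unique v × All (E y) v ×
                   (_∈ᵛ proj₁ core) ⊆ (_∈ᵛ v) ×
                   (∀ {z} → z ∈ˡ List.concatMap classes (List.allFin k) → E y z → z ∈ᵛ v))
          hull = adjoin (E y) (proj₁ core) (proj₁ (proj₂ core)) (proj₂ (proj₂ core)) _
          N : ℕ
          N = proj₁ hull
          h : Vec X N
          h = proj₁ (proj₂ hull)
          A : Pred X 0ℓ
          A = _∈ᵛ h
          core⊆A : (_∈ᵛ proj₁ core) ⊆ A
          core⊆A = proj₁ (proj₂ (proj₂ (proj₂ (proj₂ (proj₂ hull)))))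
          A⊆Ey : A ⊆ E y
          A⊆Ey = All.lookup (proj₁ (proj₂ (proj₂ (proj₂ (proj₂ hull)))))
          A-inClass : InClass E N A
          A-inClass = (h , proj₁ (proj₂ (proj₂ (proj₂ hull))) , id , id) , y , A⊆Ey
          A-contains : ∀ r {z} → F (proj₁ (bad r)) y z → z ∈ A
          A-contains r yFz = proj₂ (proj₂ (proj₂ (proj₂ (proj₂ (proj₂ hull)))))
            (∈-concatMap-intro classes (∈-allFin r) (proj₂ (class-finite (proj₁ (bad r)) y) yFz)) (F⇒E yFz)
          base : Σ[ v ∈ Vec X p ] (Unique v × (_∈ᵛ v) ⊆ A)
          base = tail (proj₁ core) (proj₁ (proj₂ core)) core⊆A
            where
            tail : (v : Vec X (suc p)) → Unique v → (_∈ᵛ v) ⊆ A → Σ[ v ∈ Vec X p ] (Unique v × (_∈ᵛ v) ⊆ A)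
            tail (x ∷ v) (_ ∷ uniq) ⊆A = v , uniq , λ z∈ → ⊆A (there z∈)
          B₀ : Pred X 0ℓ
          B₀ = _∈ᵛ proj₁ base
          -- Each `v` is compared only with `B₀`; outside the exceptions all colours then agree with
          -- that of `B₀`.
          exceptions : (v : Vec X p) → Σ[ L ∈ List X ] (∀ {z} → ¬ (z ∈ˡ L) → E y z → z ∉ A →
            Unique v → (_∈ᵛ v) ⊆ A → (a : InClass E (suc p) (｛ z ｝ ∪ (_∈ᵛ v))) (b : InClass E (suc p) (｛ z ｝ ∪ B₀)) →
            color c _ a ≡ color c _ b)
          exceptions v with em {P = Unique v × (_∈ᵛ v) ⊆ A}
          ... | no ¬uv = [] , λ _ _ _ uniq v⊆A → ⊥-elim (¬uv (uniq , v⊆A))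
          ... | yes (uniq , v⊆A) =
            let finite = transitive N (proj₁ (proj₂ (proj₂ hull))) A A-inClass (_∈ᵛ v) B₀
                  (v , uniq , id , id) (λ {x} → v⊆A {x}) (proj₁ base , proj₁ (proj₂ base) , id , id) (proj₂ (proj₂ base))
            in proj₁ finite , λ {z} z∉L yEz z∉A _ _ a b → byContradiction λ a≢b →
              z∉L (proj₂ finite (saturated yEz , z∉A ∘ v⊆A , z∉A ∘ proj₂ (proj₂ base) ,
                λ eq → a≢b (trans (color-cong c a _ (id , id)) (trans eq (color-cong c _ b (id , id))))))
            where
            saturated : ∀ {z} → E y z → z ∈ Saturation E A
            saturated yEz = let x∈ = core⊆A (head∈ (proj₁ core)) in
              Vec.head (proj₁ core) , x∈ , E.trans (E.sym (A⊆Ey x∈)) yEz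
              where
              head∈ : (v : Vec X (suc p)) → Vec.head v ∈ᵛ v
              head∈ (x ∷ v) = here refl
          excluded : List X
          -- The vectors with entries from `h` include every `v` that matters; the entries of `h`
          -- themselves are excluded to keep `w` out of `A`.
          excluded = List.concatMap (proj₁ ∘ exceptions) (vectors (Vec.toList h) p) ++ Vec.toList h
          fresh : ∃[ w ] (E y w × ¬ (w ∈ˡ excluded))
          fresh = infinite-avoids (aperiodic y) excluded
          w : X
          w = proj₁ fresh
          yEw : E y w
          yEw = proj₁ (proj₂ fresh)
          w∉A : w ∉ A
          w∉A w∈A = proj₂ (proj₂ fresh) (∈-++⁺ʳ _ (∈-toList w∈A))
          with-w : (v : Vec X p) → Unique v → (_∈ᵛ v) ⊆ A → InClass E (suc p) (｛ w ｝ ∪ (_∈ᵛ v))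
          with-w v uniq v⊆A = (w ∷ v , ∉⇒all≢ v (w∉A ∘ v⊆A) ∷ uniq ,
              (λ { (inj₁ w≡z) → here (sym w≡z) ; (inj₂ z∈v) → there z∈v }) ,
              (λ { (here z≡w) → inj₁ (sym z≡w) ; (there z∈v) → inj₂ z∈v })) ,
            y , λ { (inj₁ refl) → yEw ; (inj₂ z∈v) → A⊆Ey (v⊆A z∈v) }
          base-inClass : InClass E (suc p) (｛ w ｝ ∪ B₀)
          base-inClass = with-w (proj₁ base) (proj₁ (proj₂ base)) (proj₂ (proj₂ base))
          r₀ : Fin k
          r₀ = color c _ base-inClass
          colour : ∀ v → AllPairs _<_ v → All (λ z → F (proj₁ (bad r₀)) y z ⊎ z ≡ w) v → w ∈ᵛ v → HasColour r₀ v
          colour v inc near w∈v = hasColour-intro inc whole-inClass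
              (trans (color-cong c {A = _∈ᵛ v} {B = ｛ w ｝ ∪ (_∈ᵛ v′)} whole-inClass rest-inClass split)
                (proj₂ (exceptions v′) w∉L yEw w∉A uniq′ v′⊆A rest-inClass base-inClass))
            where
            rest : Σ[ v′ ∈ Vec X p ] (Unique v′ × w ∉ᵛ v′ × (_∈ᵛ v) ≐ (｛ w ｝ ∪ (_∈ᵛ v′)))
            rest = remove v (increasing⇒unique isStrictTotalOrder inc) w∈v
            v′ : Vec X p
            v′ = proj₁ rest
            uniq′ : Unique v′
            uniq′ = proj₁ (proj₂ rest)
            split : (_∈ᵛ v) ≐ (｛ w ｝ ∪ (_∈ᵛ v′))
            split = proj₂ (proj₂ (proj₂ rest))
            v′⊆A : (_∈ᵛ v′) ⊆ A
            v′⊆A {z} z∈v′ = inA (All.lookup near (proj₂ split (inj₂ z∈v′)))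
              where
              inA : F (proj₁ (bad r₀)) y z ⊎ z ≡ w → z ∈ A
              inA (inj₁ yFz) = A-contains r₀ yFz
              inA (inj₂ z≡w) = ⊥-elim (proj₁ (proj₂ (proj₂ rest)) (subst (_∈ᵛ v′) z≡w z∈v′))
            rest-inClass : InClass E (suc p) (｛ w ｝ ∪ (_∈ᵛ v′))
            rest-inClass = with-w v′ uniq′ v′⊆A
            whole-inClass : InClass E (suc p) (_∈ᵛ v)
            whole-inClass = inClass-≐ {A = ｛ w ｝ ∪ (_∈ᵛ v′)} {B = _∈ᵛ v} (proj₂ split , proj₁ split) rest-inClass
            w∉L : ¬ (w ∈ˡ proj₁ (exceptions v′))
            w∉L w∈L = proj₂ (proj₂ fresh) (∈-++⁺ˡ (∈-concatMap-intro (proj₁ ∘ exceptions)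
              (∈-vectors v′ (all-from-∈ v′ (λ z∈v′ → ∈-toList (v′⊆A z∈v′)))) w∈L))

    -- Borel measurability of good points, chosen colours and selections

    F-borel : ∀ i → BorelRel 𝕏 (F i)
    F-borel i = IsFiniteBorelEquivalence.isBorel (F-finite i)

    Colour : Set
    Colour = Fin k

    BorelMap : (X → X) → Set₁
    BorelMap = IsMeasurableMap 𝓑 𝓑

    abstract
      borelMaps : Σ[ g ∈ (ℕ → X → X) ] ((∀ j → BorelMap (g j)) × (∀ {x y} → E x y → ∃[ j ] g j x ≡ y))
      borelMaps = hyperfinite⇒borelMaps 𝕏 hyp

    g : ℕ → X → X
    g = proj₁ borelMaps

    g-borel : ∀ j → BorelMap (g j)
    g-borel = proj₁ (proj₂ borelMaps)

    g-covers : ∀ {x y} → E x y → ∃[ j ] g j x ≡ y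
    g-covers = proj₂ (proj₂ borelMaps)

    id-borel : BorelMap id
    id-borel _ MB = MB

    ∘-borel : ∀ {f h} → BorelMap f → BorelMap h → BorelMap (f ∘ h)
    ∘-borel {f} f-borel h-borel B MB = h-borel (f ⊢ B) (f-borel B MB)

    relation-borel : ∀ {R f h} → BorelRel 𝕏 R → BorelMap f → BorelMap h → Measurable 𝓑 (λ y → R (f y) (h y))
    relation-borel {R} R-borel f-borel h-borel = pair-measurable {𝓐 = 𝓑} {𝓑} f-borel h-borel (uncurry R) R-borel

    incomparable : ∀ {x y} → ¬ (x < y) → ¬ (y < x) → x ≡ y
    incomparable {x} {y} x≮y y≮x with IsStrictTotalOrder.compare isStrictTotalOrder x y
    ... | tri< x<y _ _ = ⊥-elim (x≮y x<y)
    ... | tri≈ _ x≡y _ = x≡y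
    ... | tri> _ _ y<x = ⊥-elim (y≮x y<x)

    -- Two points are equal exactly when neither precedes the other in the Borel order.
    equality-borel : ∀ {f h} → BorelMap f → BorelMap h → Measurable 𝓑 (λ y → f y ≡ h y)
    equality-borel {f} {h} f-borel h-borel = σ-Algebra.resp-≐ 𝓑
      ((λ (f≮h , h≮f) → incomparable f≮h h≮f) , λ f≡h → irrefl f≡h , irrefl (sym f≡h))
      (measurable-× 𝓑 (σ-Algebra.complement 𝓑 (relation-borel <-borel f-borel h-borel))
                      (σ-Algebra.complement 𝓑 (relation-borel <-borel h-borel f-borel)))
      where open IsStrictTotalOrder isStrictTotalOrder using (irrefl)

    -- Every tuple from the class of `y` is indexed by some `ι`, so a quantifier over such tuples
    -- becomes a countable one.
    tuple : ∀ {n} → Vec ℕ n → X → Vec X n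
    tuple ι y = Vec.map (λ i → g i y) ι

    tuple-covers : ∀ {n y} (v : Vec X n) → All (E y) v → ∃[ ι ] tuple ι y ≡ v
    tuple-covers []      []            = [] , refl
    tuple-covers (x ∷ v) (yEx ∷ yEv) =
      let (i , eq) = g-covers yEx ; (ι , eq′) = tuple-covers v yEv in i ∷ ι , cong₂ _∷_ eq eq′

    all-borel : ∀ {n} {P : Rel X 0ℓ} → (∀ i → Measurable 𝓑 (λ y → P y (g i y))) →
                (ι : Vec ℕ n) → Measurable 𝓑 (λ y → All (P y) (tuple ι y))
    all-borel P-borel []      = σ-Algebra.resp-≐ 𝓑 ((λ _ → []) , _) (σ-Algebra.whole 𝓑)
    all-borel P-borel (i ∷ ι) = σ-Algebra.resp-≐ 𝓑 (uncurry _∷_ , All.uncons)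
      (measurable-× 𝓑 (P-borel i) (all-borel P-borel ι))

    increasing-borel : ∀ {n} (ι : Vec ℕ n) → Measurable 𝓑 (λ y → AllPairs _<_ (tuple ι y))
    increasing-borel []      = σ-Algebra.resp-≐ 𝓑 ((λ _ → []) , _) (σ-Algebra.whole 𝓑)
    increasing-borel (i ∷ ι) = σ-Algebra.resp-≐ 𝓑 (uncurry _∷_ , AllPairs.uncons)
      (measurable-× 𝓑 (all-borel {P = λ y z → g i y < z} (λ j → relation-borel <-borel (g-borel i) (g-borel j)) ι)
                      (increasing-borel ι))

    member-borel : ∀ {n f} → BorelMap f → (ι : Vec ℕ n) → Measurable 𝓑 (λ y → f y ∈ᵛ tuple ι y)
    member-borel f-borel []      = σ-Algebra.resp-≐ 𝓑 ((λ ¬⊤ → ⊥-elim (¬⊤ _)) , λ ())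
      (σ-Algebra.complement 𝓑 (σ-Algebra.whole 𝓑))
    member-borel f-borel (i ∷ ι) = σ-Algebra.resp-≐ 𝓑
      ([ here , there ] , λ { (here eq) → inj₁ eq ; (there ∈ι) → inj₂ ∈ι })
      (measurable-⊎ 𝓑 (equality-borel f-borel (g-borel i)) (member-borel f-borel ι))

    tuple-borel : ∀ {n} (ι : Vec ℕ n) → IsMeasurableMap 𝓑 (power 𝓑 n) (tuple ι)
    tuple-borel ι = initial-universal 𝓑 𝓑 _ (tuple ι) λ l B MB → σ-Algebra.resp-≐ 𝓑
      ((λ {y} → subst B (sym (lookup-map l (λ i → g i y) ι))) , (λ {y} → subst B (lookup-map l (λ i → g i y) ι)))
      (g-borel (lookup ι l) B MB)

    good-borel : ∀ r m j → Measurable 𝓑 (λ y → Good r m y (g j y))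
    good-borel r m j = σ-Algebra.resp-≐ 𝓑 (to , from)
      (measurable-× 𝓑 (σ-Algebra.complement 𝓑 (relation-borel (F-borel m) id-borel (g-borel j)))
      (measurable-× 𝓑 (relation-borel isBorel id-borel (g-borel j))
      (measurable-∀ 𝓑 (countable-Vec countable-ℕ (suc p)) λ ι →
        measurable-→ 𝓑 (increasing-borel ι)
        (measurable-→ 𝓑 (all-borel {P = Near} (λ i → measurable-⊎ 𝓑 (relation-borel (F-borel m) id-borel (g-borel i))
                                                          (equality-borel (g-borel i) (g-borel j))) ι)
        (measurable-→ 𝓑 (member-borel (g-borel j) ι)
                        (tuple-borel ι (HasColour r) (proj₁ (proj₂ (colour-trace r)))))))))
      where
      Near : Rel X 0ℓ
      Near y z = F m y z ⊎ z ≡ g j y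
      Good′ : X → Set
      Good′ y = ¬ F m y (g j y) × E y (g j y) × (∀ (ι : Vec ℕ (suc p)) → AllPairs _<_ (tuple ι y) →
        All (Near y) (tuple ι y) → g j y ∈ᵛ tuple ι y → HasColour r (tuple ι y))
      to : ∀ {y} → Good′ y → Good r m y (g j y)
      to {y} (outside , yEw , colour) = good outside yEw λ v inc near w∈ →
        -- Each entry of `v` is in the `F m`-class of `y` or equal to `g j y`, hence in the E-class
        -- of `y`, so some `ι` indexes `v`.
        let (ι , eq) = tuple-covers v (All.map (λ { (inj₁ yFz) → F⇒E yFz ; (inj₂ refl) → yEw }) near)
        in subst (λ v → AllPairs _<_ v → All (Near y) v → g j y ∈ᵛ v → HasColour r v) eq (colour ι) inc near w∈
      from : ∀ {y} → Good r m y (g j y) → Good′ y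
      from {y} (good outside yEw colour) = outside , yEw , λ ι → colour (tuple ι y)

    good-mono : ∀ {r m m′ y w} → m ≤ m′ → Good r m′ y w → Good r m y w
    good-mono m≤m′ (good outside yEw colour) = good (outside ∘ F-mono m≤m′) yEw
      λ v inc near → colour v inc (All.map [ inj₁ ∘ F-mono m≤m′ , inj₂ ] near)

    good-invariant : ∀ {r m x y w} → F m x y → Good r m x w → Good r m y w
    good-invariant {m = m} xFy (good outside xEw colour) =
      good (outside ∘ F.trans m xFy) (E.trans (E.sym (F⇒E xFy)) xEw)
        λ v inc near → colour v inc (All.map [ inj₁ ∘ F.trans m xFy , inj₂ ] near)

    -- At level `m ⊔ i`, where `F i x y`, the two points share a class, so a good point for `x`
    -- serves `y`; it stays good at the lower level `m`.
    recurrent-invariant : ∀ {r x y} → E x y → Recurrent r x → Recurrent r y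
    recurrent-invariant {r} xEy recurrent m =
      let (i , xFy) = Equivalence.to E-union xEy ; (w , w-good) = recurrent (m ⊔ i)
      in w , good-mono (ℕ.m≤m⊔n m i) (good-invariant (F-mono (ℕ.m≤n⊔m m i) xFy) w-good)

    Chosen : Fin k → X → Set
    Chosen r y = Recurrent r y × (∀ s → s Fin.< r → ¬ Recurrent s y)

    chosen-exists : ∀ y → ∃[ r ] Chosen r y
    chosen-exists y = least toℕ (recurrent-exists y)

    chosen-unique : ∀ {r s y} → Chosen r y → Chosen s y → r ≡ s
    chosen-unique {r} {s} (r-rec , r-least) (s-rec , s-least) with Fin.<-cmp r s
    ... | tri< r<s _ _ = ⊥-elim (s-least r r<s r-rec)
    ... | tri≈ _ r≡s _ = r≡s
    ... | tri> _ _ s<r = ⊥-elim (r-least s s<r s-rec)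

    chosen-invariant : ∀ {r x y} → E x y → Chosen r x → Chosen r y
    chosen-invariant xEy (r-rec , r-least) =
      recurrent-invariant xEy r-rec , λ s s<r → r-least s s<r ∘ recurrent-invariant (E.sym xEy)

    recurrent-borel : ∀ r → Measurable 𝓑 (Recurrent r)
    recurrent-borel r = σ-Algebra.resp-≐ 𝓑 (to , from)
      (measurable-∀ 𝓑 countable-ℕ λ m → measurable-∃ 𝓑 countable-ℕ λ j → good-borel r m j)
      where
      to : ∀ {y} → (∀ m → ∃[ j ] Good r m y (g j y)) → Recurrent r y
      to {y} recurrent m = let (j , j-good) = recurrent m in g j y , j-good
      from : ∀ {y} → Recurrent r y → ∀ m → ∃[ j ] Good r m y (g j y)
      from {y} recurrent m =
        let (w , w-good) = recurrent m ; (j , eq) = g-covers (Good.inClass w-good)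
        in j , subst (Good r m y) (sym eq) w-good

    chosen-borel : ∀ r → Measurable 𝓑 (Chosen r)
    chosen-borel r = measurable-× 𝓑 (recurrent-borel r) (measurable-∀ 𝓑 (countable-Fin′ r) λ s →
      measurable-→ 𝓑 (measurable-const 𝓑 _) (σ-Algebra.complement 𝓑 (recurrent-borel s)))
      where
      countable-Fin′ : ∀ {k} → Fin k → Countable (Fin k)
      countable-Fin′ {suc k} _ = countable-Fin k

    First : (ℕ → Pred X 0ℓ) → X → Pred ℕ 0ℓ
    First P y j = P j y × (∀ i → i ℕ.< j → ¬ P i y)

    first-unique : ∀ {P y i j} → First P y i → First P y j → i ≡ j
    first-unique {i = i} {j} (Pi , i-first) (Pj , j-first) with ℕ.<-cmp i j
    ... | tri< i<j _ _ = ⊥-elim (j-first i i<j Pi)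
    ... | tri≈ _ i≡j _ = i≡j
    ... | tri> _ _ j<i = ⊥-elim (i-first j j<i Pj)

    abstract
      -- Junk value y if no P j holds at y.
      select : (ℕ → Pred X 0ℓ) → (ℕ → X → X) → X → X
      select P h y with em {P = ∃ (First P y)}
      ... | yes (j , _) = h j y
      ... | no _        = y

      select-first : ∀ P h {y j} → First P y j → select P h y ≡ h j y
      select-first P h {y} first-j with em {P = ∃ (First P y)}
      ... | yes (i , first-i) = cong (λ i → h i y) (first-unique {P} first-i first-j)
      ... | no none           = ⊥-elim (none (_ , first-j))

      select-default : ∀ P h {y} → ¬ ∃ (First P y) → select P h y ≡ y
      select-default P h {y} none with em {P = ∃ (First P y)}
      ... | yes some = ⊥-elim (none some)
      ... | no _     = refl

    select-spec : ∀ P h {y} → ∃[ j ] P j y → ∃[ j ] (P j y × select P h y ≡ h j y)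
    select-spec P h some = let (j , first-j) = least id some in j , proj₁ first-j , select-first P h first-j

    select-borel : ∀ {P h} → (∀ j → Measurable 𝓑 (P j)) → (∀ j → BorelMap (h j)) → BorelMap (select P h)
    select-borel {P} {h} P-borel h-borel B MB = σ-Algebra.resp-≐ 𝓑 (to , from)
      (measurable-⊎ 𝓑 (measurable-∃ 𝓑 countable-ℕ λ j → measurable-× 𝓑 (first-borel j) (h-borel j B MB))
                      (measurable-× 𝓑 (σ-Algebra.complement 𝓑 (measurable-∃ 𝓑 countable-ℕ first-borel)) MB))
      where
      first-borel : ∀ j → Measurable 𝓑 (λ y → First P y j)
      first-borel j = measurable-× 𝓑 (P-borel j) (measurable-∀ 𝓑 countable-ℕ λ i →
        measurable-→ 𝓑 (measurable-const 𝓑 _) (σ-Algebra.complement 𝓑 (P-borel i)))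
      Cases : Pred X 0ℓ
      Cases y = (∃[ j ] (First P y j × B (h j y))) ⊎ (¬ ∃ (First P y) × B y)
      to : ∀ {y} → Cases y → B (select P h y)
      to (inj₁ (j , first-j , b)) = subst B (sym (select-first P h first-j)) b
      to (inj₂ (none , b))        = subst B (sym (select-default P h none)) b
      from : ∀ {y} → B (select P h y) → Cases y
      from {y} b with em {P = ∃ (First P y)}
      ... | yes (j , first-j) = inj₁ (j , first-j , subst B (select-first P h first-j) b)
      ... | no none           = inj₂ (none , subst B (select-default P h none) b)

    -- Representatives and the recursive construction of the sequence

    IsLeast : ℕ → X → Pred X 0ℓ
    IsLeast k x z = F k x z × (∀ i → F k x (g i x) → ¬ (g i x < z))

    representative : ℕ → X → X
    representative k = select (λ j x → IsLeast k x (g j x)) g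

    representative-borel : ∀ k → BorelMap (representative k)
    representative-borel k = select-borel
      (λ j → measurable-× 𝓑 (relation-borel (F-borel k) id-borel (g-borel j))
        (measurable-∀ 𝓑 countable-ℕ λ i → measurable-→ 𝓑 (relation-borel (F-borel k) id-borel (g-borel i))
          (σ-Algebra.complement 𝓑 (relation-borel <-borel (g-borel i) (g-borel j)))))
      g-borel

    representative-least : ∀ k x → IsLeast k x (representative k x)
    representative-least k x =
      let (z , xFz , z-min) = minimum isStrictTotalOrder (class-finite k x) (x , F.refl k)
          (j , gx≡z) = g-covers (F⇒E xFz)
          (_ , is-least , eq) = select-spec (λ j x → IsLeast k x (g j x)) g
            (j , subst (IsLeast k x) (sym gx≡z) (xFz , λ i xFg → z-min (g i x) xFg))
      in subst (IsLeast k x) (sym eq) is-least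

    representative-below : ∀ {k x y} → F k x y → ¬ (representative k y < representative k x)
    representative-below {k} {x} {y} xFy lt =
      let xFr = F.trans k xFy (proj₁ (representative-least k y)) ; (i , eq) = g-covers (F⇒E xFr)
      in proj₂ (representative-least k x) i (subst (F k x) (sym eq) xFr) (subst (_< _) (sym eq) lt)

    representative-invariant : ∀ {k x y} → F k x y → representative k x ≡ representative k y
    representative-invariant {k} xFy =
      incomparable (representative-below (F.sym k xFy)) (representative-below xFy)

    -- Applied at the representative `y` of an `F k`-class. No bound is known beforehand for a level
    -- `m` that captures the earlier values on this class, so `m` is searched for together with the
    -- index `j` of the new point.
    Candidate : ℕ → List (X → X) → ℕ × ℕ → X → Set
    Candidate k prev (m , j) y =
      (∀ i → F k y (g i y) → Allˡ (λ h → F m y (h (g i y))) prev) × (∃[ r ] (Chosen r y × Good r m y (g j y)))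

    -- Selecting at the representative makes the result constant on `F k`-classes.
    next : ℕ → List (X → X) → X → X
    next k prev = select (Candidate k prev ∘ unpair) (g ∘ proj₂ ∘ unpair) ∘ representative k

    -- Course-of-values recursion: the list carries all earlier functions, latest first, which keeps
    -- the recursion structural.
    previous : ℕ → List (X → X)
    previous zero    = []
    previous (suc k) = next k (previous k) ∷ previous k

    u : ℕ → X → X
    u k = next k (previous k)

    u∈previous : ∀ {j k} → j ℕ.< k → u j ∈ˡ previous k
    u∈previous j<k = go (ℕ.≤⇒≤′ j<k)
      where
      go : ∀ {j k} → suc j ℕ.≤′ k → u j ∈ˡ previous k
      go ℕ.≤′-refl     = here refl
      go (ℕ.≤′-step p) = there (go p)

    next-borel : ∀ k {prev} → Allˡ BorelMap prev → BorelMap (next k prev)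
    next-borel k {prev} prev-borel = ∘-borel
      (select-borel {Candidate k prev ∘ unpair} (λ t → candidate-borel (unpair t)) (λ t → g-borel (proj₂ (unpair t))))
      (representative-borel k)
      where
      preserved-borel : ∀ {hs} m i → Allˡ BorelMap hs → Measurable 𝓑 (λ y → Allˡ (λ h → F m y (h (g i y))) hs)
      preserved-borel m i []               = σ-Algebra.resp-≐ 𝓑 ((λ _ → []) , _) (σ-Algebra.whole 𝓑)
      preserved-borel m i (h-borel ∷ rest) = σ-Algebra.resp-≐ 𝓑 (uncurry _∷_ , ListAll.uncons)
        (measurable-× 𝓑 (relation-borel (F-borel m) id-borel (∘-borel h-borel (g-borel i))) (preserved-borel m i rest))
      candidate-borel : ∀ t → Measurable 𝓑 (Candidate k prev t)
      candidate-borel (m , j) = measurable-× 𝓑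
        (measurable-∀ 𝓑 countable-ℕ λ i → measurable-→ 𝓑 (relation-borel (F-borel k) id-borel (g-borel i))
          (preserved-borel m i prev-borel))
        (measurable-∃-Fin λ r → measurable-× 𝓑 (chosen-borel r) (good-borel r m j))
        where
        measurable-∃-Fin : ∀ {k} {A : Fin k → Pred X 0ℓ} → (∀ r → Measurable 𝓑 (A r)) → Measurable 𝓑 (λ y → ∃[ r ] A r y)
        measurable-∃-Fin {zero}  _  = σ-Algebra.resp-≐ 𝓑 ((λ ()) , λ ()) (measurable-const 𝓑 ⊥)
        measurable-∃-Fin {suc k} MA = measurable-∃ 𝓑 (countable-Fin k) MA

    u-borel : ∀ k → BorelMap (u k)
    u-borel k = next-borel k (previous-borel k)
      where
      previous-borel : ∀ k → Allˡ BorelMap (previous k)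
      previous-borel zero    = []
      previous-borel (suc k) = next-borel k (previous-borel k) ∷ previous-borel k

    -- A candidate always exists: the `F k`-class and `prev` are finite and the values stay in the
    -- E-class, so one level `N` captures them all, and recurrence of the chosen colour supplies a
    -- good point at level `N`. Hence `select` never falls back on its default here.
    next-spec : ∀ k {prev} → Allˡ (λ h → ∀ z → E z (h z)) prev → ∀ x → ∃[ m ] ∃[ r ]
      ( (∀ z → F k x z → Allˡ (λ h → F m (representative k x) (h z)) prev)
      × Chosen r x × Good r m (representative k x) (next k prev x))
    next-spec k {prev} prev-inClass x =
      m′ , s ,
      (λ z xFz → let yFz = F.trans k (F.sym k xFy) xFz ; (i , eq) = g-covers (F⇒E yFz) in
         subst (λ z → Allˡ (λ h → F m′ y (h z)) prev) eq (preserved i (subst (F k y) (sym eq) yFz))) ,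
      chosen-invariant (E.sym (F⇒E xFy)) s-chosen ,
      subst (Good s m′ y) (sym select≡) w-good
      where
      y : X
      y = representative k x
      xFy : F k x y
      xFy = proj₁ (representative-least k x)
      orbit-bound : ∀ z → ∃[ N ] (∀ m → N ≤ m → F k y z → Allˡ (λ h → F m y (h z)) prev)
      orbit-bound z with em {P = F k y z}
      ... | no ¬yFz = 0 , λ _ _ yFz → ⊥-elim (¬yFz yFz)
      ... | yes yFz =
        let (N , bound) = uniform-bound {P = λ h m → F m y (h z)} prev λ h∈ →
              let (i , yFhz) = Equivalence.to E-union (E.trans (F⇒E yFz) (ListAll.lookup prev-inClass h∈ z))
              in i , λ m i≤m → F-mono i≤m yFhz
        in N , λ m N≤m _ → ListAll.tabulate (bound m N≤m)
      exists : ∃[ t ] Candidate k prev (unpair t) y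
      exists =
        let (N , bound) = uniform-bound {P = λ z m → F k y z → Allˡ (λ h → F m y (h z)) prev}
              (proj₁ (class-finite k y)) (λ {z} _ → orbit-bound z)
            (r , chosen) = chosen-exists y
            (w , w-good) = proj₁ chosen N
            (j , eq) = g-covers (Good.inClass w-good)
            (t , t≡) = unpair-surjective (N , j)
        in t , subst (λ t → Candidate k prev t y) (sym t≡)
             ((λ i yFg → bound N ℕ.≤-refl (proj₂ (class-finite k y) yFg) yFg) ,
              r , chosen , subst (Good r N y) (sym eq) w-good)
      selected : ∃[ t ] (Candidate k prev (unpair t) y × next k prev x ≡ g (proj₂ (unpair t)) y)
      selected = select-spec (Candidate k prev ∘ unpair) (g ∘ proj₂ ∘ unpair) exists
      m′ : ℕ
      m′ = proj₁ (unpair (proj₁ selected))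
      preserved : ∀ i → F k y (g i y) → Allˡ (λ h → F m′ y (h (g i y))) prev
      preserved = proj₁ (proj₁ (proj₂ selected))
      s : Colour
      s = proj₁ (proj₂ (proj₁ (proj₂ selected)))
      s-chosen : Chosen s y
      s-chosen = proj₁ (proj₂ (proj₂ (proj₁ (proj₂ selected))))
      w-good : Good s m′ y (g (proj₂ (unpair (proj₁ selected))) y)
      w-good = proj₂ (proj₂ (proj₂ (proj₁ (proj₂ selected))))
      select≡ : next k prev x ≡ g (proj₂ (unpair (proj₁ selected))) y
      select≡ = proj₂ (proj₂ selected)

    previous-inClass : ∀ k → Allˡ (λ h → ∀ z → E z (h z)) (previous k)
    previous-inClass zero    = []
    previous-inClass (suc k) = (λ z →
        let (_ , _ , _ , _ , w-good) = next-spec k (previous-inClass k) z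
        in E.trans (F⇒E (proj₁ (representative-least k z))) (Good.inClass w-good))
      ∷ previous-inClass k

    u-inClass : ∀ k x → E x (u k x)
    u-inClass k = ListAll.lookup (previous-inClass (suc k)) (here refl)

    u-spec : ∀ k x → ∃[ m ] ∃[ r ]
      ( (∀ {j} → j ℕ.< k → F m (representative k x) (u j x))
      × Chosen r x × Good r m (representative k x) (u k x))
    u-spec k x =
      let (m , r , preserved , chosen , w-good) = next-spec k (previous-inClass k) x
      in m , r , (λ j<k → ListAll.lookup (preserved x (F.refl k)) (u∈previous j<k)) , chosen , w-good

    -- At step `k` the earlier values at `x` lie in the `F m`-class of the representative, and a
    -- good point lies outside it.
    u-distinct : ∀ {j k} → j ℕ.< k → ∀ x → u j x ≢ u k x
    u-distinct {k = k} j<k x eq =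
      let (m , _ , earlier , _ , w-good) = u-spec k x
      in Good.outside w-good (subst (F m (representative k x)) eq (earlier j<k))

    u-invariant : ∀ {k x y} → F k x y → u k x ≡ u k y
    u-invariant {k} xFy = cong (select (Candidate k (previous k) ∘ unpair) (g ∘ proj₂ ∘ unpair)) (representative-invariant xFy)

    -- The monochromatic reduction

    S : X → ℕ → X
    S x k = u k x

    -- Singles out an entry whose index bounds those of the others. For `S x` it is the entry chosen
    -- last, and its choice fixes the colour of the whole set.
    last-entry : ∀ {n} (s : ℕ → X) (v : Vec X (suc n)) → All (range s) v →
                 ∃[ k ] (s k ∈ᵛ v × All (λ z → ∃[ l ] (l ≤ k × s l ≡ z)) v)
    last-entry s (x ∷ []) ((l , eq) ∷ []) = l , here eq , (l , ℕ.≤-refl , eq) ∷ []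
    last-entry s (x ∷ v@(_ ∷ _)) ((l , eq) ∷ v⊆) with last-entry s v v⊆
    ... | k , sk∈v , below with ℕ.≤-total l k
    ...   | inj₁ l≤k = k , there sk∈v , (l , l≤k , eq) ∷ below
    ...   | inj₂ k≤l = l , here eq , (l , ℕ.≤-refl , eq) ∷ All.map (λ (i , i≤k , eq) → i , ℕ.≤-trans i≤k k≤l , eq) below

    -- After sorting `A`, its latest entry `u k x` is good at a level where the class of the
    -- representative contains all the other entries, so `Good.colour` applies. The colour used at
    -- step `k` is `r` because the chosen colour is unique.
    range-colour : ∀ {x r} → Chosen r x → (A : Pred X 0ℓ) (a : InClass E (suc p) A) → A ⊆ range (S x) → color c A a ≡ r
    range-colour {x} {r} chosen A a@((v , uniq , A⊆v , v⊆A) , _) A⊆S =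
      trans (Coloring.color-cong c {A} {_∈ᵛ v′} a a′ A≐v′) (hasColour-elim inc a′ coloured)
      where
      sorted : Σ[ v′ ∈ Vec X (suc p) ] (AllPairs _<_ v′ × (_∈ᵛ v) ≐ (_∈ᵛ v′))
      sorted = sort isStrictTotalOrder v uniq
      v′ : Vec X (suc p)
      v′ = proj₁ sorted
      inc : AllPairs _<_ v′
      inc = proj₁ (proj₂ sorted)
      A≐v′ : A ≐ (_∈ᵛ v′)
      A≐v′ = proj₁ (proj₂ (proj₂ sorted)) ∘ A⊆v , v⊆A ∘ proj₂ (proj₂ (proj₂ sorted))
      a′ : InClass E (suc p) (_∈ᵛ v′)
      a′ = inClass-≐ {A = A} {B = _∈ᵛ v′} A≐v′ a
      top : ∃[ k ] (S x k ∈ᵛ v′ × All (λ z → ∃[ l ] (l ≤ k × S x l ≡ z)) v′)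
      top = last-entry (S x) v′ (all-from-∈ v′ (λ z∈ → A⊆S (proj₂ A≐v′ z∈)))
      coloured : HasColour r v′
      coloured =
        let (k , uk∈v′ , below) = top ; (m , s , earlier , chosen′ , w-good) = u-spec k x
        in subst (λ r → HasColour r v′) (chosen-unique chosen′ chosen)
             (Good.colour w-good v′ inc (All.map (near earlier) below) uk∈v′)
        where
        near : ∀ {m k z} → (∀ {j} → j ℕ.< k → F m (representative k x) (u j x)) →
               ∃[ l ] (l ≤ k × S x l ≡ z) → F m (representative k x) z ⊎ z ≡ u k x
        near {m} {k} earlier (l , l≤k , refl) with ℕ.m≤n⇒m<n∨m≡n l≤k
        ... | inj₁ l<k  = inj₁ (earlier l<k)
        ... | inj₂ refl = inj₂ refl

    S-borel : IsMeasurableMap 𝓑 (sequences 𝓑) S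
    S-borel = initial-universal 𝓑 𝓑 _ S u-borel

    S-reduction : IsMonochromaticReduction c S
    S-reduction = record
      { distinct      = λ x {i} {j} i≢j → distinct x (ℕ.<-cmp i j) i≢j
      ; monochromatic = λ x → record
          { inClass  = λ { (i , refl) → u-inClass i x }
          ; constant = λ A B sizeA sizeB A⊆S B⊆S → let (r , chosen) = chosen-exists x in
              trans (range-colour chosen A _ A⊆S) (sym (range-colour chosen B _ B⊆S)) }
      ; reduction     = λ x y → mk⇔ (to x y) (from x y)
      }
      where
      distinct : ∀ x {i j} → Tri (i ℕ.< j) (i ≡ j) (j ℕ.< i) → i ≢ j → S x i ≢ S x j
      distinct x (tri< i<j _ _) _   = u-distinct i<j x
      distinct x (tri≈ _ i≡j _) i≢j = ⊥-elim (i≢j i≡j)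
      distinct x (tri> _ _ j<i) _   = u-distinct j<i x ∘ sym
      to : ∀ x y → E x y → E₁ (S x) (S y)
      -- From `i` on, `x` and `y` are `F j`-related, and `u j` is constant on `F j`-classes.
      to x y xEy = let (i , xFy) = Equivalence.to E-union xEy in i , λ j i≤j → u-invariant (F-mono i≤j xFy)
      from : ∀ x y → E₁ (S x) (S y) → E x y
      -- A single common entry lies in both classes.
      from x y (i , same) =
        E.trans (u-inClass i x) (subst (λ z → E z y) (sym (same i ℕ.≤-refl)) (E.sym (u-inClass i y)))

theorem3p4 : (∀ {ℓ} → ExcludedMiddle ℓ) →
    (X : StandardBorelSpace) →
    (_<_ : Rel (Carrier X) 0ℓ) (ord : IsBorelLinearOrder X _<_) →
    (E : Rel (Carrier X) 0ℓ) (hyp : IsHyperfinite X E) → Aperiodic E →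
    (n k : ℕ) .{{_ : NonZero n}} .{{_ : NonZero k}} →
    (c : Coloring E n k) → IsBorelColoring X ord c →
    AlmostTransitive (IsHyperfinite.isEquivalence hyp) c →
    Σ[ S ∈ (Carrier X → ℕ → Carrier X) ]
    (IsMeasurableMap (borel X) (sequences (borel X)) S × IsMonochromaticReduction c S)
theorem3p4 em 𝕏 _<_ ord E hyp aperiodic zero k {{n≢0}} c c-borel transitive = ⊥-elim (ℕ.≢-nonZero⁻¹ 0 {{n≢0}} refl)
theorem3p4 em 𝕏 _<_ ord E hyp aperiodic (suc p) k c c-borel transitive =
  S em 𝕏 ord hyp aperiodic c c-borel transitive ,
  S-borel em 𝕏 ord hyp aperiodic c c-borel transitive ,
  S-reduction em 𝕏 ord hyp aperiodic c c-borel transitive
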